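{- The validity problem $\mathrm{Val}(\mathrm{RmbC})=\{\varphi:\ \vdash_{\mathrm{RmbC}}\varphi\}$ is $\mathsf{coNP}$-hard.
   Context: Hardness is with respect to polynomial-time many-one reductions. Formulas are built from a countably infinite set of propositional variables using binary $\wedge,\vee,\to$ and unary $\neg,\circ$; $\alpha\leftrightarrow\beta$ abbreviates $(\alpha\to\beta)\wedge(\beta\to\alpha)$. The logic $\mathrm{RmbC}$ is given by the Hilbert calculus with axiom schemas $\alpha\to(\beta\to\alpha)$; $(\alpha\to(\beta\to\gamma))\to((\alpha\to\beta)\to(\alpha\to\gamma))$; $\alpha\to(\beta\to(\alpha\wedge\beta))$; $(\alpha\wedge\beta)\to\alpha$; $(\alpha\wedge\beta)\to\beta$; $\alpha\to(\alpha\vee\beta)$; $\beta\to(\alpha\vee\beta)$; $(\alpha\to\gamma)\to((\beta\to\gamma)\to((\alpha\vee\beta)\to\gamma))$; $(\alpha\to\beta)\vee\alpha$; $\alpha\vee\neg\alpha$; $\circ\alpha\to(\alpha\to(\neg\alpha\to\beta))$; and inference rules: modus ponens; $(R_\neg)$: from $\alpha\leftrightarrow\psi$ infer $\neg\alpha\leftrightarrow\neg\psi$; $(R_\circ)$: from $\alpha\leftrightarrow\psi$ infer $\circ\alpha\leftrightarrow\circ\psi$. $\vdash_{\mathrm{RmbC}}\varphi$ means $\varphi$ is derivable in this calculus (without premises). -}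

module Defs where

open import Data.Bool.Base using (Bool; true; false)
open import Data.Fin.Base using (Fin)
open import Data.List.Base as List using (List; []; _∷_; _++_; length)
open import Data.Nat.Base using (ℕ; suc; _+_; _*_; _^_)
open import Data.Nat.Binary.Base using (ℕᵇ; zero; 2[1+_]; 1+[2_]; fromℕ)
open import Data.Product.Base using (Σ-syntax; ∃-syntax; _×_; _,_)
open import Data.Unit.Base using (⊤; tt)
open import Data.Vec.Base as Vec using (Vec; []; _∷_)
open import Function.Bundles using (_↔_; _⇔_)
open import Level using (0ℓ)
open import Relation.Binary.PropositionalEquality.Core using (_≡_)
open import Relation.Unary using (Pred; ∁; _≐_)

------------------------------------------------------------------------
-- Multi-tape Turing machines

-- Tape alphabets contain a blank and the two input bits; `aux` gives the
-- remaining symbols.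
data Symbol (A : Set) : Set where
  blank : Symbol A
  bit   : Bool → Symbol A
  aux   : A → Symbol A

data Move : Set where
  left right stay : Move

-- A two-way infinite tape.  Both lists are ordered outwards from the
-- scanned cell, and all cells beyond their ends are blank.
record Tape (A : Set) : Set where
  constructor ⟨_,_,_⟩
  field
    before  : List (Symbol A)
    scanned : Symbol A
    after   : List (Symbol A)
open Tape public

blankTape : ∀ {A} → Tape A
blankTape = ⟨ [] , blank , [] ⟩

inputTape : ∀ {A} → List Bool → Tape A
inputTape []       = blankTape
inputTape (b ∷ bs) = ⟨ [] , bit b , List.map bit bs ⟩

move : ∀ {A} → Move → Tape A → Tape A
move stay  t                    = t
move left  ⟨ []     , s , rs ⟩ = ⟨ [] , blank , s ∷ rs ⟩
move left  ⟨ l ∷ ls , s , rs ⟩ = ⟨ ls , l , s ∷ rs ⟩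
move right ⟨ ls , s , []     ⟩ = ⟨ s ∷ ls , blank , [] ⟩
move right ⟨ ls , s , r ∷ rs ⟩ = ⟨ s ∷ ls , r , rs ⟩

writeMove : ∀ {A} → Symbol A × Move → Tape A → Tape A
writeMove (s , m) ⟨ ls , _ , rs ⟩ = move m ⟨ ls , s , rs ⟩

leadingBits : ∀ {A} → List (Symbol A) → List Bool
leadingBits (bit b ∷ ss) = b ∷ leadingBits ss
leadingBits _            = []

-- The bits from the scanned cell rightwards up to the first non-bit.
tapeOutput : ∀ {A} → Tape A → List Bool
tapeOutput t = leadingBits (scanned t ∷ after t)

-- The full state set of a machine is `Control Q`, with Q its non-halting
-- states.
data Control (Q : Set) : Set where
  running       : Q → Control Q
  accept reject : Control Q

data Halting {Q : Set} : Control Q → Set where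
  accept : Halting accept
  reject : Halting reject

-- There is one transition function for each element of Choice.
record TM (Choice : Set) : Set₁ where
  field
    State        : Set
    finite-State : ∃[ n ] (State ↔ Fin n)
    Aux          : Set
    finite-Aux   : ∃[ n ] (Aux ↔ Fin n)
    workTapes    : ℕ
    start        : State
    δ            : Choice → State → Vec (Symbol Aux) (suc workTapes) →
                   Control State × Vec (Symbol Aux × Move) (suc workTapes)

DTM NTM : Set₁
DTM = TM ⊤
NTM = TM Bool

module _ {Choice : Set} (M : TM Choice) where
  open TM M

  record Config : Set where
    constructor config
    field
      control : Control State
      tapes   : Vec (Tape Aux) (suc workTapes)

  -- The input, and later the output, is on the first tape.
  initial : List Bool → Config
  initial x = config (running start) (inputTape x ∷ Vec.replicate workTapes blankTape)

  step : Choice → Config → Config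
  step b (config (running q) ts) with δ b q (Vec.map scanned ts)
  ... | q′ , acts = config q′ (Vec.zipWith writeMove acts ts)
  step b c = c

  run : ∀ {t} → Vec Choice t → Config → Config
  run []       c = c
  run (b ∷ bs) c = run bs (step b c)

  output : Config → List Bool
  output c = tapeOutput (Vec.head (Config.tapes c))

open Config public

------------------------------------------------------------------------
-- Complexity

Language : Set₁
Language = Pred (List Bool) 0ℓ

polyBound : ℕ → ℕ → ℕ → ℕ
polyBound c k n = c * n ^ k + c

PolyTime : (List Bool → List Bool) → Set₁
PolyTime f =
  Σ[ M ∈ DTM ] ∃[ c ] ∃[ k ] (∀ x →
    let final = run M (Vec.replicate (polyBound c k (length x)) tt) (initial M x)
    in Halting (control final) × output M final ≡ f x)

-- Halting configurations are fixed by `step`, so choice sequences of length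
-- exactly the time bound represent all computations within that bound.
NP : Language → Set₁
NP L =
  Σ[ M ∈ NTM ] ∃[ c ] ∃[ k ] (∀ x →
    let Choices = Vec Bool (polyBound c k (length x))
        final   = λ (bs : Choices) → control (run M bs (initial M x))
    in (∀ bs → Halting (final bs)) × (L x ⇔ (∃[ bs ] final bs ≡ accept)))

-- Since L need not be stable under double negation, being the complement of
-- an NP language is the appropriate constructive form of ∁ L being in NP.
coNP : Language → Set₁
coNP L = Σ[ K ∈ Language ] (NP K × L ≐ ∁ K)

infix 4 _≤ᵖ_

_≤ᵖ_ : Language → Language → Set₁
L ≤ᵖ L′ = Σ[ f ∈ (List Bool → List Bool) ] (PolyTime f × (∀ x → L x ⇔ L′ (f x)))

coNP-hard : Language → Set₁
coNP-hard L′ = ∀ L → coNP L → L ≤ᵖ L′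

------------------------------------------------------------------------
-- The logic RmbC

infix  9 ¬_ ∘_
infixr 7 _∧_
infixr 6 _∨_
infixr 5 _⇒_
infix  4 _⟷_
infix  3 ⊢_

data Formula : Set where
  var         : ℕ → Formula
  _∧_ _∨_ _⇒_ : Formula → Formula → Formula
  ¬_ ∘_       : Formula → Formula

_⟷_ : Formula → Formula → Formula
α ⟷ β = (α ⇒ β) ∧ (β ⇒ α)

data ⊢_ : Formula → Set where
  K     : ∀ α β → ⊢ α ⇒ (β ⇒ α)
  S     : ∀ α β γ → ⊢ (α ⇒ (β ⇒ γ)) ⇒ ((α ⇒ β) ⇒ (α ⇒ γ))
  ∧-I   : ∀ α β → ⊢ α ⇒ (β ⇒ (α ∧ β))
  ∧-E₁  : ∀ α β → ⊢ (α ∧ β) ⇒ α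
  ∧-E₂  : ∀ α β → ⊢ (α ∧ β) ⇒ β
  ∨-I₁  : ∀ α β → ⊢ α ⇒ (α ∨ β)
  ∨-I₂  : ∀ α β → ⊢ β ⇒ (α ∨ β)
  ∨-E   : ∀ α β γ → ⊢ (α ⇒ γ) ⇒ ((β ⇒ γ) ⇒ ((α ∨ β) ⇒ γ))
  ⇒-∨   : ∀ α β → ⊢ (α ⇒ β) ∨ α
  em    : ∀ α → ⊢ α ∨ (¬ α)
  bc    : ∀ α β → ⊢ (∘ α) ⇒ (α ⇒ ((¬ α) ⇒ β))
  mp    : ∀ {α β} → ⊢ α → ⊢ α ⇒ β → ⊢ β
  R¬    : ∀ {α β} → ⊢ α ⟷ β → ⊢ (¬ α) ⟷ (¬ β)
  R∘    : ∀ {α β} → ⊢ α ⟷ β → ⊢ (∘ α) ⟷ (∘ β)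

-- Self-delimiting: each binary digit (least significant first, bijective
-- base 2 as in ℕᵇ) is preceded by `true`, and `false` ends the numeral.
encodeℕᵇ : ℕᵇ → List Bool
encodeℕᵇ zero     = false ∷ []
encodeℕᵇ 1+[2 n ] = true ∷ false ∷ encodeℕᵇ n
encodeℕᵇ 2[1+ n ] = true ∷ true ∷ encodeℕᵇ n

-- Polish notation with a three-bit tag per constructor; a prefix code, hence
-- injective.
encode : Formula → List Bool
encode (var i) = false ∷ false ∷ false ∷ encodeℕᵇ (fromℕ i)
encode (α ∧ β) = false ∷ false ∷ true  ∷ encode α ++ encode β
encode (α ∨ β) = false ∷ true  ∷ false ∷ encode α ++ encode β
encode (α ⇒ β) = false ∷ true  ∷ true  ∷ encode α ++ encode β
encode (¬ α)   = true  ∷ false ∷ false ∷ encode α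
encode (∘ α)   = true  ∷ false ∷ true  ∷ encode α

Val-RmbC : Language
Val-RmbC w = ∃[ φ ] (w ≡ encode φ × ⊢ φ)

{-# OPTIONS --safe #-}
module Submission where

-- A Cook–Levin reduction with Horn clauses.  All runs of a machine for an NP
-- language halt, so x is outside of the language iff all runs on x reject.
-- The facts of a tableau say which choice is made, which state is entered, and
-- which symbol is at which distance from the head, at time t.  The formula
-- derives rejection at the time bound from the initial facts, the local rules
-- of the machine and the disjunctions "choice true ∨ choice false".
--
-- If all runs reject, then forward chaining with a case distinction on every
-- choice is a derivation; it only needs the deduction theorem and ∨-elimination,
-- not the completeness of a fragment of RmbC.  Conversely, reading ¬ classically
-- and ∘ as truth is sound, and the valuation of an accepting run satisfies all
-- hypotheses of the formula and refutes its conclusion.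
--
-- The formula is printed by a program with stacks, one on each tape of the
-- machine that it is compiled to.  It is printed from its end to its beginning,
-- so that printing is pushing.  In bijective base 2 every bit string is a
-- numeral, so variables can be named by times and distances in unary, and these
-- are heights of stacks.

open import Defs
open import Data.Bool.Base using (Bool; true; false)
open import Data.Empty using (⊥; ⊥-elim)
open import Data.Fin.Base using (Fin; zero; suc; toℕ)
open import Data.Fin.Properties using (1↔⊤; 2↔Bool; +↔⊎; toℕ-injective)
open import Data.List.Base as List
  using (List; []; _∷_; _++_; length; reverse; _ʳ++_; foldr; replicate; concatMap; allFin;
         cartesianProductWith)
open import Data.List.Membership.Propositional using (_∈_; lose)
open import Data.List.Membership.Propositional.Properties
  using (∈-++⁺ˡ; ∈-++⁺ʳ; ∈-map⁺; ∈-concatMap⁺; ∈-cartesianProductWith⁺; ∈-allFin)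
open import Data.List.Properties
  using (++-assoc; ++-identityʳ; reverse-involutive; length-reverse; length-++; length-replicate;
         ∷-injectiveˡ; ∷-injectiveʳ)
open import Data.List.Relation.Binary.Subset.Propositional using (_⊆_)
open import Data.List.Relation.Unary.All as All using (All; []; _∷_)
import Data.List.Relation.Unary.All.Properties as All
open import Data.List.Relation.Unary.Any using (here; there)
open import Data.Maybe.Base as Maybe using (Maybe; just; nothing; maybe; _>>=_)
open import Data.Nat.Base as ℕ using (ℕ; zero; suc; _+_; _*_; _^_; _≤_; _<_; z≤n; s≤s)
open import Data.Nat.Binary.Base using (ℕᵇ; zero; 2[1+_]; 1+[2_]; fromℕ) renaming (toℕ to toℕ₂)
import Data.Nat.Binary.Properties as ℕᵇ
open import Data.Nat.Properties
open import Data.Nat.Tactic.RingSolver using (solve-∀)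
open import Data.Product.Base using (∃-syntax; _×_; _,_; proj₁; proj₂; map₁; map₂)
open import Data.Sum.Base using (_⊎_; inj₁; inj₂)
open import Data.Sum.Function.Propositional using (_⊎-↔_)
open import Data.Unit.Base using (⊤; tt)
open import Data.Vec.Base as Vec using (Vec; []; _∷_; lookup; updateAt; _[_]≔_)
open import Data.Vec.Properties
  using (lookup-map; map-updateAt; updateAt-updateAt; map-replicate; lookup-zipWith;
         lookup-replicate; tabulate∘lookup; tabulate-cong)
open import Function.Base using (_∘′_)
open import Function.Bundles using (_↔_; Inverse; Injection; Equivalence; mk⇔)
open import Function.Construct.Composition using (_↔-∘_)
open import Function.Construct.Identity using (↔-id)
open import Function.Construct.Symmetry using (↔-sym)
open import Function.Properties.Inverse using (↔⇒↣)
open import Relation.Binary.PropositionalEquality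
open import Relation.Nullary.Negation.Core using (DoubleNegation)

-- Polynomial bounds

record PolyBounded (f : ℕ → ℕ) : Set where
  constructor poly
  field
    coefficient degree : ℕ
    bound              : ∀ n → f n ≤ polyBound coefficient degree n

-- The summand 1 is for base 0, where the power with exponent 0 is 1 but the larger exponent may
-- give 0.
n^k≤n^[k+l]+1 : ∀ n k l → n ^ k ≤ n ^ (k + l) + 1
n^k≤n^[k+l]+1 n       zero    l = m≤n+m 1 (n ^ l)
n^k≤n^[k+l]+1 zero    (suc k) l = z≤n
n^k≤n^[k+l]+1 (suc n) (suc k) l =
  ≤-trans (^-monoʳ-≤ (suc n) (m≤m+n (suc k) l)) (m≤m+n _ 1)

n^l≤n^[k+l]+1 : ∀ n k l → n ^ l ≤ n ^ (k + l) + 1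
n^l≤n^[k+l]+1 n k l = subst (λ m → n ^ l ≤ n ^ m + 1) (+-comm l k) (n^k≤n^[k+l]+1 n l k)

PolyBounded-const : ∀ c → PolyBounded (λ _ → c)
PolyBounded-const c = poly c 0 λ n → m≤n+m c (c * 1)

PolyBounded-id : PolyBounded (λ n → n)
PolyBounded-id = poly 1 1 λ n → ≤-trans (≤-reflexive (lemma n)) (m≤m+n _ 1)
  where
  lemma : ∀ n → n ≡ 1 * (n * 1)
  lemma = solve-∀

PolyBounded-+ : ∀ {f g} → PolyBounded f → PolyBounded g → PolyBounded (λ n → f n + g n)
PolyBounded-+ {f} {g} (poly c k f≤) (poly d l g≤) = poly ((c + d) + (c + d)) (k + l) λ n → begin
  f n + g n
    ≤⟨ +-mono-≤ (f≤ n) (g≤ n) ⟩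
  (c * n ^ k + c) + (d * n ^ l + d)
    ≤⟨ +-mono-≤ (+-monoˡ-≤ c (*-monoʳ-≤ c (n^k≤n^[k+l]+1 n k l)))
                (+-monoˡ-≤ d (*-monoʳ-≤ d (n^l≤n^[k+l]+1 n k l))) ⟩
  (c * (n ^ (k + l) + 1) + c) + (d * (n ^ (k + l) + 1) + d)
    -- `polyBound` uses one number both as coefficient and as constant. The constant is already
    -- twice `c + d`, so the coefficient is raised to match.
    ≤⟨ m≤m+n _ ((c + d) * n ^ (k + l)) ⟩
  (c * (n ^ (k + l) + 1) + c) + (d * (n ^ (k + l) + 1) + d) + (c + d) * n ^ (k + l)
    ≡⟨ lemma c d (n ^ (k + l)) ⟩
  polyBound ((c + d) + (c + d)) (k + l) n ∎
  where
  open ≤-Reasoning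
  lemma : ∀ c d p → (c * (p + 1) + c) + (d * (p + 1) + d) + (c + d) * p ≡
                    (c + d + (c + d)) * p + (c + d + (c + d))
  lemma = solve-∀

PolyBounded-* : ∀ {f g} → PolyBounded f → PolyBounded g → PolyBounded (λ n → f n * g n)
PolyBounded-* {f} {g} (poly c k f≤) (poly d l g≤) = poly (3 * (c * d)) (k + l) λ n → begin
  f n * g n
    ≤⟨ *-mono-≤ (f≤ n) (g≤ n) ⟩
  (c * n ^ k + c) * (d * n ^ l + d)
    ≡⟨ expand c d (n ^ k) (n ^ l) ⟩
  c * d * (n ^ k * n ^ l) + c * d * n ^ k + c * d * n ^ l + c * d
    ≤⟨ +-monoˡ-≤ (c * d)
         (+-mono-≤ (+-mono-≤ (≤-reflexive (cong (c * d *_) (sym (^-distribˡ-+-* n k l))))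
                             (*-monoʳ-≤ (c * d) (n^k≤n^[k+l]+1 n k l)))
                   (*-monoʳ-≤ (c * d) (n^l≤n^[k+l]+1 n k l))) ⟩
  c * d * n ^ (k + l) + c * d * (n ^ (k + l) + 1) + c * d * (n ^ (k + l) + 1) + c * d
    ≡⟨ collect (c * d) (n ^ (k + l)) ⟩
  polyBound (3 * (c * d)) (k + l) n ∎
  where
  open ≤-Reasoning
  expand : ∀ c d p q → (c * p + c) * (d * q + d) ≡
                       c * d * (p * q) + c * d * p + c * d * q + c * d
  expand = solve-∀
  collect : ∀ e p → e * p + e * (p + 1) + e * (p + 1) + e ≡ 3 * e * p + 3 * e
  collect = solve-∀

PolyBounded-^ : ∀ k → PolyBounded (λ n → n ^ k)
PolyBounded-^ zero    = PolyBounded-const 1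
PolyBounded-^ (suc k) = PolyBounded-* PolyBounded-id (PolyBounded-^ k)

-- A language of stack programs

infixr 6 _⨾_

-- `loop` is the only test and the only pop. It consumes the stack that it counts with, so a height
-- that is needed again has to be saved on another stack.
data Prog (k : ℕ) : Set where
  skip : Prog k
  push : Fin k → Bool → Prog k
  _⨾_  : Prog k → Prog k → Prog k
  loop : Fin k → (Bool → Prog k) → Prog k

Stacks : ℕ → Set
Stacks k = Vec (List Bool) k

-- `Exec p σ n σ′`: p turns σ into σ′ within n steps of the machine it is compiled to.
data Exec {k : ℕ} : Prog k → Stacks k → ℕ → Stacks k → Set where
  slack     : ∀ {p σ m n σ′} → m ≤ n → Exec p σ m σ′ → Exec p σ n σ′
  skip      : ∀ {σ} → Exec skip σ 1 σ
  push      : ∀ {j b σ} → Exec (push j b) σ 2 (updateAt σ j (b ∷_))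
  _⨾_       : ∀ {p q σ m σ′ n σ″} → Exec p σ m σ′ → Exec q σ′ n σ″ →
              Exec (p ⨾ q) σ (m + n) σ″
  loop-done : ∀ {j p σ} → lookup σ j ≡ [] → Exec (loop j p) σ 1 σ
  loop-next : ∀ {j p σ b w m σ′ n σ″} → lookup σ j ≡ b ∷ w →
              Exec (p b) (σ [ j ]≔ w) m σ′ → Exec (loop j p) σ′ n σ″ →
              Exec (loop j p) σ (suc (m + n)) σ″

retime : ∀ {k} {p : Prog k} {σ m n σ′} → m ≡ n → Exec p σ m σ′ → Exec p σ n σ′
retime refl e = e

-- The extra symbols are `Fin 0`, so the first non-bit is always a blank and
-- `tapeOutput` reads off the stack that a tape stores.
Sym : Set
Sym = Symbol (Fin 0)

-- Compilation of stack programs to Turing machines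

module _ {k : ℕ} where

  Action : Set
  Action = Vec (Sym × Move) k

  keep : Vec Sym k → Action
  keep = Vec.map (_, stay)

  -- These become the states of the machine. A machine writes before it moves, so `push` takes two
  -- steps: the head goes left, and then the bit is written there. A loop is at its test or inside
  -- one of its two bodies.
  Position : Prog k → Set
  Position skip       = ⊤
  Position (push _ _) = Bool
  Position (p ⨾ q)    = Position p ⊎ Position q
  Position (loop _ p) = ⊤ ⊎ (Position (p false) ⊎ Position (p true))

  entry : ∀ p → Position p
  entry skip       = tt
  entry (push _ _) = false
  entry (p ⨾ _)    = inj₁ (entry p)
  entry (loop _ _) = inj₁ tt

  inBody : ∀ j p b → Position (p b) → Position (loop j p)
  inBody j p false s = inj₂ (inj₁ s)
  inBody j p true  s = inj₂ (inj₂ s)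

  -- `nothing` is the exit of a program. The transition that leaves the first program already enters
  -- the second one, so sequencing costs no step; likewise the exit of a loop body leads back to the
  -- test.
  inFirst : ∀ p q → Maybe (Position p) → Maybe (Position (p ⨾ q))
  inFirst p q r = just (maybe inj₁ (inj₂ (entry q)) r)

  inSecond : ∀ p q → Maybe (Position q) → Maybe (Position (p ⨾ q))
  inSecond p q = Maybe.map inj₂

  repeating : ∀ j p b → Maybe (Position (p b)) → Maybe (Position (loop j p))
  repeating j p b r = just (maybe (inBody j p b) (inj₁ tt) r)

  transition : ∀ p → Position p → Vec Sym k → Maybe (Position p) × Action
  transition skip _ σ           = nothing , keep σ
  transition (push j b) false σ = just true , updateAt (keep σ) j (map₂ (λ _ → left))
  transition (push j b) true σ  = nothing , keep σ [ j ]≔ (bit b , stay)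
  transition (p ⨾ q) (inj₁ s) σ = map₁ (inFirst p q) (transition p s σ)
  transition (p ⨾ q) (inj₂ s) σ = map₁ (inSecond p q) (transition q s σ)
  transition (loop j p) (inj₁ tt) σ with lookup σ j
  ... | blank = nothing , keep σ
  -- The stack begins at the head, so moving right pops. What stays behind on the left is
  -- overwritten by the next push without being inspected.
  ... | bit b = just (inBody j p b (entry (p b))) , keep σ [ j ]≔ (blank , right)
  transition (loop j p) (inj₂ (inj₁ s)) σ = map₁ (repeating j p false) (transition (p false) s σ)
  transition (loop j p) (inj₂ (inj₂ s)) σ = map₁ (repeating j p true) (transition (p true) s σ)

  Tapes : Set
  Tapes = Vec (Tape (Fin 0)) k

  act : Action → Tapes → Tapes
  act = Vec.zipWith writeMove

  -- `Runs p s ts n ts′`: p, started in position s, is left within n steps.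
  data Runs (p : Prog k) : Position p → Tapes → ℕ → Tapes → Set where
    leave : ∀ {s ts a n} → transition p s (Vec.map scanned ts) ≡ (nothing , a) →
            Runs p s ts (suc n) (act a ts)
    advance : ∀ {s s′ ts a n ts′} → transition p s (Vec.map scanned ts) ≡ (just s′ , a) →
              Runs p s′ (act a ts) n ts′ → Runs p s ts (suc n) ts′

  Runs-mono : ∀ {p s ts m n ts′} → m ≤ n → Runs p s ts m ts′ → Runs p s ts n ts′
  Runs-mono (s≤s m≤n) (leave e)  = leave e
  Runs-mono (s≤s m≤n) (advance e r) = advance e (Runs-mono m≤n r)

  Runs-⨾ʳ : ∀ {p q s ts n ts′} → Runs q s ts n ts′ → Runs (p ⨾ q) (inj₂ s) ts n ts′
  Runs-⨾ʳ {p} {q} (leave e)  = leave (cong (map₁ (inSecond p q)) e)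
  Runs-⨾ʳ {p} {q} (advance e r) = advance (cong (map₁ (inSecond p q)) e) (Runs-⨾ʳ r)

  Runs-⨾ : ∀ {p q s ts m ts′ n ts″} → Runs p s ts m ts′ → Runs q (entry q) ts′ n ts″ →
           Runs (p ⨾ q) (inj₁ s) ts (m + n) ts″
  Runs-⨾ {p} {q} (leave {n = m} e) r =
    advance (cong (map₁ (inFirst p q)) e) (Runs-mono (m≤n+m _ m) (Runs-⨾ʳ r))
  Runs-⨾ {p} {q} (advance e r) r′ = advance (cong (map₁ (inFirst p q)) e) (Runs-⨾ r r′)

  transition-inBody : ∀ {j p} b s σ →
    transition (loop j p) (inBody j p b s) σ ≡ map₁ (repeating j p b) (transition (p b) s σ)
  transition-inBody false s σ = refl
  transition-inBody true  s σ = refl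

  Runs-body : ∀ {j p} b {s ts m ts′ n ts″} → Runs (p b) s ts m ts′ →
              Runs (loop j p) (inj₁ tt) ts′ n ts″ →
              Runs (loop j p) (inBody j p b s) ts (m + n) ts″
  Runs-body {j} {p} b (leave {n = m} e) r =
    advance (trans (transition-inBody b _ _) (cong (map₁ (repeating j p b)) e)) (Runs-mono (m≤n+m _ m) r)
  Runs-body {j} {p} b (advance e r) r′ =
    advance (trans (transition-inBody b _ _) (cong (map₁ (repeating j p b)) e)) (Runs-body b r r′)

keep-act : ∀ {k} (ts : Tapes {k}) → act (keep (Vec.map scanned ts)) ts ≡ ts
keep-act []       = refl
keep-act (t ∷ ts) = cong (t ∷_) (keep-act ts)

update-act : ∀ {k} (ts : Tapes {k}) j {f} →
  act (updateAt (keep (Vec.map scanned ts)) j f) ts ≡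
  updateAt ts j (λ t → writeMove (f (scanned t , stay)) t)
update-act (t ∷ ts) zero    = cong (_ ∷_) (keep-act ts)
update-act (t ∷ ts) (suc j) = cong (t ∷_) (update-act ts j)

stacks : ∀ {k} → Tapes {k} → Stacks k
stacks = Vec.map tapeOutput

tapeOutput-push : ∀ (t : Tape (Fin 0)) b →
  tapeOutput (writeMove (bit b , stay) (writeMove (scanned t , left) t)) ≡ b ∷ tapeOutput t
tapeOutput-push ⟨ []    , s , rs ⟩ b = refl
tapeOutput-push ⟨ _ ∷ _ , s , rs ⟩ b = refl

tapeOutput-pop : ∀ (t : Tape (Fin 0)) {b w} → tapeOutput t ≡ b ∷ w →
  scanned t ≡ bit b × tapeOutput (writeMove (blank , right) t) ≡ w
tapeOutput-pop ⟨ _ , bit b , []     ⟩ refl = refl , refl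
tapeOutput-pop ⟨ _ , bit b , r ∷ rs ⟩ refl = refl , refl

tapeOutput-empty : ∀ (t : Tape (Fin 0)) → tapeOutput t ≡ [] → scanned t ≡ blank
tapeOutput-empty ⟨ _ , blank , _ ⟩ refl = refl

-- Only the stacks are determined, not the tapes: cells left of a head or beyond the first blank may
-- hold anything.
Exec⇒Runs : ∀ {k p} {σ : Stacks k} {n σ′} → Exec p σ n σ′ →
  ∀ ts → stacks ts ≡ σ → ∃[ ts′ ] Runs p (entry p) ts n ts′ × stacks ts′ ≡ σ′
Exec⇒Runs (slack m≤n e) ts refl with Exec⇒Runs e ts refl
... | ts′ , r , eq = ts′ , Runs-mono m≤n r , eq
Exec⇒Runs skip ts refl = _ , leave refl , cong stacks (keep-act ts)
Exec⇒Runs (push {j} {b}) ts refl = _ , advance refl (leave refl) , (begin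
  stacks (act (keep (Vec.map scanned ts₁) [ j ]≔ (bit b , stay)) ts₁)
    ≡⟨ cong stacks (update-act ts₁ j) ⟩
  stacks (updateAt ts₁ j (writeMove (bit b , stay)))
    ≡⟨ cong (λ ts → stacks (updateAt ts j (writeMove (bit b , stay)))) (update-act ts j) ⟩
  stacks (updateAt (updateAt ts j (λ t → writeMove (scanned t , left) t)) j
            (writeMove (bit b , stay)))
    ≡⟨ cong stacks (updateAt-updateAt j ts) ⟩
  stacks (updateAt ts j (λ t → writeMove (bit b , stay) (writeMove (scanned t , left) t)))
    ≡⟨ map-updateAt ts j (tapeOutput-push (lookup ts j) b) ⟩
  updateAt (stacks ts) j (b ∷_) ∎)
  where
  open ≡-Reasoning
  ts₁ = act _ ts
Exec⇒Runs (e ⨾ e′) ts refl with Exec⇒Runs e ts refl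
... | ts′ , r , refl with Exec⇒Runs e′ ts′ refl
... | ts″ , r′ , eq = ts″ , Runs-⨾ r r′ , eq
Exec⇒Runs {p = loop j p} (loop-done empty) ts refl = _ , leave test , cong stacks (keep-act ts)
  where
  sees : lookup (Vec.map scanned ts) j ≡ blank
  sees = trans (lookup-map j scanned ts)
           (tapeOutput-empty (lookup ts j) (trans (sym (lookup-map j tapeOutput ts)) empty))
  test : transition (loop j p) (inj₁ tt) (Vec.map scanned ts) ≡ (nothing , keep (Vec.map scanned ts))
  test rewrite sees = refl
Exec⇒Runs {p = loop j p} (loop-next {b = b} {w} full e e′) ts refl = go
  where
  popped : scanned (lookup ts j) ≡ bit b × tapeOutput (writeMove (blank , right) (lookup ts j)) ≡ w
  popped = tapeOutput-pop (lookup ts j) (trans (sym (lookup-map j tapeOutput ts)) full)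
  a = keep (Vec.map scanned ts) [ j ]≔ (blank , right)
  test : transition (loop j p) (inj₁ tt) (Vec.map scanned ts) ≡ (just (inBody j p b (entry (p b))) , a)
  test rewrite trans (lookup-map j scanned ts) (proj₁ popped) = refl
  rest : stacks (act a ts) ≡ stacks ts [ j ]≔ w
  rest = trans (cong stacks (update-act ts j)) (map-updateAt ts j (proj₂ popped))
  go : ∃[ ts′ ] Runs (loop j p) (inj₁ tt) ts _ ts′ × stacks ts′ ≡ _
  go with Exec⇒Runs e (act a ts) rest
  ... | ts′ , r , refl with Exec⇒Runs e′ ts′ refl
  ... | ts″ , r′ , eq = ts″ , advance test (Runs-body b r r′) , eq

finite-Position : ∀ {k} (p : Prog k) → ∃[ n ] (Position p ↔ Fin n)
finite-Position skip       = 1 , ↔-sym 1↔⊤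
finite-Position (push _ _) = 2 , ↔-sym 2↔Bool
finite-Position (p ⨾ q) with finite-Position p | finite-Position q
... | m , f | n , g = m + n , ↔-sym +↔⊎ ↔-∘ (f ⊎-↔ g)
finite-Position (loop j p) with finite-Position (p false) | finite-Position (p true)
... | m , f | n , g =
  1 + (m + n) , ↔-sym (+↔⊎ {1}) ↔-∘ (↔-sym 1↔⊤ ⊎-↔ (↔-sym +↔⊎ ↔-∘ (f ⊎-↔ g)))

module _ {k : ℕ} (p : Prog (suc k)) where

  machine : DTM
  machine = record
    { State        = Position p
    ; finite-State = finite-Position p
    ; Aux          = Fin 0
    ; finite-Aux   = 0 , ↔-id (Fin 0)
    ; workTapes    = k
    ; start        = entry p
    ; δ            = λ _ s σ → map₁ (maybe running accept) (transition p s σ)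
    }

  run-halted : ∀ n {c : Control (Position p)} {ts} → Halting c →
    run machine (Vec.replicate n tt) (config c ts) ≡ config c ts
  run-halted zero    h      = refl
  run-halted (suc n) accept = run-halted n accept
  run-halted (suc n) reject = run-halted n reject

  run-machine : ∀ {s ts n ts′} → Runs p s ts n ts′ →
    run machine (Vec.replicate n tt) (config (running s) ts) ≡ config accept ts′
  run-machine {ts = ts} (leave {n = n} e) rewrite e = run-halted n accept
  run-machine (advance e r) rewrite e = run-machine r

leadingBits-map-bit : ∀ {A} w → leadingBits (List.map (bit {A}) w) ≡ w
leadingBits-map-bit []      = refl
leadingBits-map-bit (b ∷ w) = cong (b ∷_) (leadingBits-map-bit w)

tapeOutput-inputTape : ∀ {A} w → tapeOutput (inputTape {A} w) ≡ w
tapeOutput-inputTape []      = refl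
tapeOutput-inputTape (b ∷ w) = cong (b ∷_) (leadingBits-map-bit w)

-- The first stack serves as input and as output. A machine that halts before the polynomial bound
-- stays in its final configuration until then.
Exec⇒PolyTime : ∀ {k} (p : Prog (suc k)) (f : List Bool → List Bool) {τ} → PolyBounded τ →
  (∀ x → ∃[ σ ] Exec p (x ∷ Vec.replicate k []) (τ (length x)) (f x ∷ σ)) → PolyTime f
Exec⇒PolyTime {k} p f (poly c d τ≤) execs = machine p , c , d , correct
  where
  correct : ∀ x → let final = run (machine p) (Vec.replicate (polyBound c d (length x)) tt)
                                (initial (machine p) x)
                  in Halting (control final) × output (machine p) final ≡ f x
  correct x with execs x
  ... | σ , e with Exec⇒Runs (slack (τ≤ (length x)) e) (inputTape x ∷ Vec.replicate k blankTape)
                     (cong₂ _∷_ (tapeOutput-inputTape x) (map-replicate tapeOutput blankTape k))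
  ... | t ∷ ts , r , eq rewrite run-machine p r = accept , cong Vec.head eq

-- Names of variables and templates of formulas

ones : ℕ → ℕᵇ → ℕᵇ
ones zero    b = b
ones (suc n) b = ones n 2[1+ b ]

-- Each field is a run of digits 2 closed by a digit 1, with the least significant digit first. A
-- field is thus printed by pushing one digit per unit of a height.
fields : List ℕ → ℕᵇ
fields []       = zero
fields (n ∷ ns) = ones n 1+[2 fields ns ]

-- X holds the input reversed; the heights of C and T are a cell and a time.
data Register : Set where
  X C T : Register

data Index : Set where
  #_  : ℕ → Index
  ht  : Register → Index
  1+_ : Index → Index
  _⊕_ : Index → Index → Index

infixr 5 _⊃_

-- A formula whose variables are named by heights of registers: one fixed program prints its
-- instances for all times and cells.
data Template : Set where
  atom : (t i : Index) → List ℕ → Template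
  _⊃_  : Template → Template → Template
  _⊔_  : Template → Template → Template

module _ (ρ : Register → ℕ) where

  eval : Index → ℕ
  eval (# n)   = n
  eval (ht r)  = ρ r
  eval (1+ i)  = suc (eval i)
  eval (i ⊕ j) = eval i + eval j

  instantiate : Template → Formula
  instantiate (atom t i ns) = var (toℕ₂ (fields (eval t ∷ eval i ∷ ns)))
  instantiate (a ⊃ b)   = instantiate a ⇒ instantiate b
  instantiate (a ⊔ b)   = instantiate a ∨ instantiate b

-- Programs that print templates

pattern O = zero
pattern D = suc (suc (suc zero))
pattern W = suc (suc (suc (suc (suc zero))))

slot : Register → Fin 6
slot X = suc zero
slot C = suc (suc zero)
slot T = suc (suc (suc (suc zero)))

-- The first stack is the output, and the input at the outset. D accumulates results and keeps bits
-- popped by loops; W is scratch space for reading a register.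
store : (o : List Bool) → (Register → List Bool) → (d w : List Bool) → Stacks 6
store o κ d w = o ∷ κ X ∷ κ C ∷ d ∷ κ T ∷ w ∷ []

infixl 9 _⟨_≔_⟩

_⟨_≔_⟩ : (Register → List Bool) → Register → List Bool → Register → List Bool
(κ ⟨ X ≔ u ⟩) X = u
(κ ⟨ C ≔ u ⟩) C = u
(κ ⟨ T ≔ u ⟩) T = u
(κ ⟨ _ ≔ u ⟩) r = κ r

-- The two functions agree only pointwise, but `store` looks at no more than their three values.
store-≔ : ∀ {o d w} κ r → store o (κ ⟨ r ≔ κ r ⟩) d w ≡ store o κ d w
store-≔ κ X = refl
store-≔ κ C = refl
store-≔ κ T = refl

-- The programs that print push onto O, hence the last bits first.
emitOnes : ℕ → Prog 6
emitOnes zero    = skip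
emitOnes (suc n) = push O true ⨾ push O true ⨾ emitOnes n

-- Reading a height empties the register, so its bits go to W and back; the two reversals cancel.
unload reload : Register → Prog 6
unload r = loop (slot r) (λ b → push W b ⨾ push O true ⨾ push O true)
reload r = loop W (push (slot r))

emitIndex : Index → Prog 6
emitIndex (# n)   = emitOnes n
emitIndex (ht r)  = unload r ⨾ reload r
emitIndex (1+ i)  = push O true ⨾ push O true ⨾ emitIndex i
emitIndex (i ⊕ j) = emitIndex i ⨾ emitIndex j

separate : Prog 6
separate = push O false ⨾ push O true

emitFields : List ℕ → Prog 6
emitFields []       = push O false
emitFields (n ∷ ns) = emitFields ns ⨾ separate ⨾ emitOnes n

emitTag : Bool → Bool → Bool → Prog 6
emitTag b b′ b″ = push O b″ ⨾ push O b′ ⨾ push O b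

emit : Template → Prog 6
emit (atom t i ns) =
  emitFields ns ⨾ separate ⨾ emitIndex i ⨾ separate ⨾ emitIndex t ⨾ emitTag false false false
emit (a ⊃ b)   = emit b ⨾ emit a ⨾ emitTag false true true
emit (a ⊔ b)   = emit b ⨾ emit a ⨾ emitTag false true false

emitHypotheses : List Template → Prog 6
emitHypotheses []       = skip
emitHypotheses (a ∷ as) = emitHypotheses as ⨾ emit a ⨾ emitTag false true true

-- The part of an encoded iterated implication that precedes its conclusion. Leaving the rest `o`
-- open lets lists of hypotheses be printed piece by piece, each in front of the previous one.
encodeHypotheses : List Formula → List Bool → List Bool
encodeHypotheses []      o = o
encodeHypotheses (α ∷ Γ) o = false ∷ true ∷ true ∷ encode α ++ encodeHypotheses Γ o

timeFields : List ℕ → ℕ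
timeFields []       = 2
timeFields (n ∷ ns) = timeFields ns + (4 + (n * 4 + 1))

module _ (B : ℕ) where

  timeIndex : Index → ℕ
  timeIndex (# n)   = n * 4 + 1
  timeIndex (ht r)  = (B * 7 + 1) + (B * 3 + 1)
  timeIndex (1+ i)  = 4 + timeIndex i
  timeIndex (i ⊕ j) = timeIndex i + timeIndex j

  time : Template → ℕ
  time (atom t i ns) = timeFields ns + (4 + (timeIndex i + (4 + (timeIndex t + 6))))
  time (a ⊃ b)   = time b + (time a + 6)
  time (a ⊔ b)   = time b + (time a + 6)

  timeHypotheses : List Template → ℕ
  timeHypotheses []       = 1
  timeHypotheses (a ∷ as) = timeHypotheses as + (time a + 6)

Exec-emitOnes : ∀ κ n {b o d w} →
  Exec (emitOnes n) (store (encodeℕᵇ b ++ o) κ d w) (n * 4 + 1) (store (encodeℕᵇ (ones n b) ++ o) κ d w)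
Exec-emitOnes κ zero    = skip
Exec-emitOnes κ (suc n) = push ⨾ push ⨾ Exec-emitOnes κ n

Exec-unload : ∀ κ r u {b o d w} →
  Exec (unload r) (store (encodeℕᵇ b ++ o) (κ ⟨ r ≔ u ⟩) d w) (length u * 7 + 1)
    (store (encodeℕᵇ (ones (length u) b) ++ o) (κ ⟨ r ≔ [] ⟩) d (u ʳ++ w))
Exec-unload κ X []      = loop-done refl
Exec-unload κ C []      = loop-done refl
Exec-unload κ T []      = loop-done refl
Exec-unload κ X (_ ∷ u) = loop-next refl (push ⨾ push ⨾ push) (Exec-unload κ X u)
Exec-unload κ C (_ ∷ u) = loop-next refl (push ⨾ push ⨾ push) (Exec-unload κ C u)
Exec-unload κ T (_ ∷ u) = loop-next refl (push ⨾ push ⨾ push) (Exec-unload κ T u)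

Exec-reload : ∀ κ r w {u o d} →
  Exec (reload r) (store o (κ ⟨ r ≔ u ⟩) d w) (length w * 3 + 1) (store o (κ ⟨ r ≔ w ʳ++ u ⟩) d [])
Exec-reload κ r []      = loop-done refl
Exec-reload κ X (_ ∷ w) = loop-next refl push (Exec-reload κ X w)
Exec-reload κ C (_ ∷ w) = loop-next refl push (Exec-reload κ C w)
Exec-reload κ T (_ ∷ w) = loop-next refl push (Exec-reload κ T w)

ones-+ : ∀ m n b → ones (m + n) b ≡ ones n (ones m b)
ones-+ zero    n b = refl
ones-+ (suc m) n b = ones-+ m n 2[1+ b ]

Exec-separate : ∀ κ b {o d w} →
  Exec separate (store (encodeℕᵇ b ++ o) κ d w) 4 (store (encodeℕᵇ 1+[2 b ] ++ o) κ d w)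
Exec-separate κ b = push ⨾ push

Exec-emitFields : ∀ κ ns {o d w} →
  Exec (emitFields ns) (store o κ d w) (timeFields ns) (store (encodeℕᵇ (fields ns) ++ o) κ d w)
Exec-emitFields κ []       = push
Exec-emitFields κ (n ∷ ns) =
  Exec-emitFields κ ns ⨾ Exec-separate κ (fields ns) ⨾ Exec-emitOnes κ n {b = 1+[2 fields ns ]}

module _ (κ : Register → List Bool) {ρ : Register → ℕ} {d : List Bool} {B : ℕ}
         (heights : ∀ r → length (κ r) ≡ ρ r) (bounded : ∀ r → ρ r ≤ B) where

  -- The time depends on the common bound B instead of the actual heights, so that all iterations of
  -- a loop get the same bound.
  Exec-emitIndex : ∀ i {b o} →
    Exec (emitIndex i) (store (encodeℕᵇ b ++ o) κ d []) (timeIndex B i)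
      (store (encodeℕᵇ (ones (eval ρ i) b) ++ o) κ d [])
  Exec-emitIndex (# n)  = Exec-emitOnes κ n
  Exec-emitIndex (ht r) {b} {o} =
    subst₂ (λ σ σ′ → Exec (emitIndex (ht r)) σ (timeIndex B (ht r)) σ′)
      (store-≔ κ r)
      (trans (cong₂ (λ n u → store (encodeℕᵇ (ones n b) ++ o) (κ ⟨ r ≔ u ⟩) d [])
                (heights r) (reverse-involutive (κ r)))
             (store-≔ κ r))
      (slack (+-mono-≤ (+-monoˡ-≤ 1 (*-monoˡ-≤ 7 short))
                (+-monoˡ-≤ 1 (*-monoˡ-≤ 3 (subst (_≤ B) (sym (length-reverse (κ r))) short))))
        (Exec-unload κ r (κ r) ⨾ Exec-reload κ r (reverse (κ r))))
    where
    short : length (κ r) ≤ B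
    short = subst (_≤ B) (sym (heights r)) (bounded r)
  Exec-emitIndex (1+ i) = push ⨾ push ⨾ Exec-emitIndex i
  Exec-emitIndex (i ⊕ j) {b} rewrite ones-+ (eval ρ i) (eval ρ j) b =
    Exec-emitIndex i ⨾ Exec-emitIndex j

  Exec-emit : ∀ a {o} →
    Exec (emit a) (store o κ d []) (time B a) (store (encode (instantiate ρ a) ++ o) κ d [])
  Exec-emit (atom t i ns) rewrite ℕᵇ.fromℕ-toℕ (fields (eval ρ t ∷ eval ρ i ∷ ns)) =
    Exec-emitFields κ ns ⨾ Exec-separate κ (fields ns) ⨾ Exec-emitIndex i {b = 1+[2 fields ns ]} ⨾
    Exec-separate κ (fields (eval ρ i ∷ ns)) ⨾ Exec-emitIndex t {b = 1+[2 fields (eval ρ i ∷ ns) ]} ⨾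
    push ⨾ push ⨾ push
  Exec-emit (a ⊃ b) {o}
    rewrite ++-assoc (encode (instantiate ρ a)) (encode (instantiate ρ b)) o =
    Exec-emit b ⨾ Exec-emit a ⨾ push ⨾ push ⨾ push
  Exec-emit (a ⊔ b) {o}
    rewrite ++-assoc (encode (instantiate ρ a)) (encode (instantiate ρ b)) o =
    Exec-emit b ⨾ Exec-emit a ⨾ push ⨾ push ⨾ push

  Exec-emitHypotheses : ∀ as {o} →
    Exec (emitHypotheses as) (store o κ d []) (timeHypotheses B as)
      (store (encodeHypotheses (List.map (instantiate ρ) as) o) κ d [])
  Exec-emitHypotheses []       = skip
  Exec-emitHypotheses (a ∷ as) = Exec-emitHypotheses as ⨾ Exec-emit a ⨾ push ⨾ push ⨾ push

-- Families indexed by heights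

module _ {A : Set} where

  -- The largest index stands last because a loop meets the greatest height first, and what is
  -- printed first ends up last. Heights are taken after the pop, hence below n.
  gather : (ℕ → List A) → ℕ → List A
  gather f zero    = []
  gather f (suc n) = gather f n ++ f n

  -- f receives a bit and the number of bits after it.
  gatherBits : (ℕ → Bool → List A) → List Bool → List A
  gatherBits f []      = []
  gatherBits f (b ∷ u) = gatherBits f u ++ f (length u) b

heights : (n i t : ℕ) → Register → ℕ
heights n i t X = n
heights n i t C = i
heights n i t T = t

contents : (u c t : List Bool) → Register → List Bool
contents u c t X = u
contents u c t C = c
contents u c t T = t

contents-heights : ∀ u c t r → length (contents u c t r) ≡ heights (length u) (length c) (length t) r
contents-heights u c t X = refl
contents-heights u c t C = refl
contents-heights u c t T = refl

memory : (o u c d t w : List Bool) → Stacks 6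
memory o u c d t w = store o (contents u c t) d w

-- Unary arithmetic on the heights of stacks

-- D accumulates, X survives by way of W, and T is consumed and then refilled with the product.
addX mulTX : Prog 6
addX  = loop (slot X) (λ b → push W b ⨾ push D true) ⨾ loop W (push (slot X))
mulTX = loop (slot T) (λ _ → addX) ⨾ loop D (push (slot T))

powTX : ℕ → Prog 6
powTX zero    = skip
powTX (suc k) = mulTX ⨾ powTX k

pushD : ℕ → Prog 6
pushD zero    = skip
pushD (suc c) = pushD c ⨾ push D true

timeAddX : ℕ → ℕ
timeAddX n = (n * 5 + 1) + (n * 3 + 1)

timePowTX : ℕ → ℕ → ℕ → ℕ
timePowTX zero    n a = 1
timePowTX (suc k) n a = ((a * suc (timeAddX n) + 1) + (a * n * 3 + 1)) + timePowTX k n (a * n)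

-- Only the height of the result is specified, as the bits on a counter are irrelevant.
Exec-addX : ∀ u {o c d t} → ∃[ d′ ] length d′ ≡ length u + length d ×
  Exec addX (memory o u c d t []) (timeAddX (length u)) (memory o u c d′ t [])
Exec-addX u {o} {c} {d} {t} with walk u d []
  where
  walk : ∀ v d w → ∃[ d′ ] length d′ ≡ length v + length d ×
    Exec (loop (slot X) (λ b → push W b ⨾ push D true)) (memory o v c d t w) (length v * 5 + 1)
      (memory o [] c d′ t (v ʳ++ w))
  walk []      d w = d , refl , loop-done refl
  walk (b ∷ v) d w with walk v (true ∷ d) (b ∷ w)
  ... | d′ , l , e = d′ , trans l (+-suc (length v) (length d)) , loop-next refl (push ⨾ push) e
... | d′ , l , e = d′ , l , (e ⨾
  subst (λ v → Exec (loop W (push (slot X))) (memory o [] c d′ t (reverse u)) (length u * 3 + 1)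
                 (memory o v c d′ t []))
    (reverse-involutive u) (retime (cong (λ n → n * 3 + 1) (length-reverse u)) (back (reverse u))))
  where
  back : ∀ w {v} → Exec (loop W (push (slot X))) (memory o v c d′ t w) (length w * 3 + 1)
                     (memory o (w ʳ++ v) c d′ t [])
  back []      = loop-done refl
  back (_ ∷ w) = loop-next refl push (back w)

Exec-moveDT : ∀ d {o u c t} →
  Exec (loop D (push (slot T))) (memory o u c d t []) (length d * 3 + 1) (memory o u c [] (d ʳ++ t) [])
Exec-moveDT []      = loop-done refl
Exec-moveDT (_ ∷ d) = loop-next refl push (Exec-moveDT d)

Exec-moveDC : ∀ d {o u c t} →
  Exec (loop D (push (slot C))) (memory o u c d t []) (length d * 3 + 1) (memory o u (d ʳ++ c) [] t [])
Exec-moveDC []      = loop-done refl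
Exec-moveDC (_ ∷ d) = loop-next refl push (Exec-moveDC d)

Exec-mulTX : ∀ t {o u c} → ∃[ t′ ] length t′ ≡ length t * length u ×
  Exec mulTX (memory o u c [] t [])
    ((length t * suc (timeAddX (length u)) + 1) + (length t * length u * 3 + 1)) (memory o u c [] t′ [])
Exec-mulTX t {o} {u} {c} with walk t []
  where
  walk : ∀ t d → ∃[ d′ ] length d′ ≡ length t * length u + length d ×
    Exec (loop (slot T) (λ _ → addX)) (memory o u c d t []) (length t * suc (timeAddX (length u)) + 1)
      (memory o u c d′ [] [])
  walk []      d = d , refl , loop-done refl
  walk (b ∷ t) d with Exec-addX u {o} {c} {d} {t}
  ... | d₁ , l₁ , e₁ with walk t d₁
  ... | d₂ , l₂ , e₂ = d₂ , len , retime eq (loop-next refl e₁ e₂)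
    where
    lemma : ∀ p q r → p + (q + r) ≡ q + p + r
    lemma = solve-∀
    len : length d₂ ≡ length u + length t * length u + length d
    len = trans l₂ (trans (cong (length t * length u +_) l₁) (lemma (length t * length u) (length u) _))
    eq : suc (timeAddX (length u) + (length t * suc (timeAddX (length u)) + 1)) ≡
         suc (length t) * suc (timeAddX (length u)) + 1
    eq = sym (+-assoc (suc (timeAddX (length u))) (length t * suc (timeAddX (length u))) 1)
... | d , l , e = reverse d , trans (length-reverse d) l′ ,
  (e ⨾ retime (cong (λ n → n * 3 + 1) l′) (Exec-moveDT d))
  where
  l′ : length d ≡ length t * length u
  l′ = trans l (+-identityʳ _)

Exec-powTX : ∀ k t {o u c} → ∃[ t′ ] length t′ ≡ length t * length u ^ k ×
  Exec (powTX k) (memory o u c [] t []) (timePowTX k (length u) (length t)) (memory o u c [] t′ [])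
Exec-powTX zero    t = t , sym (*-identityʳ (length t)) , skip
Exec-powTX (suc k) t {o} {u} {c} with Exec-mulTX t {o} {u} {c}
... | t₁ , l₁ , e₁ with Exec-powTX k t₁ {o} {u} {c}
... | t₂ , l₂ , e₂ rewrite l₁ =
  t₂ , trans l₂ (*-assoc (length t) (length u) (length u ^ k)) , (e₁ ⨾ e₂)

Exec-pushD : ∀ c {o u v d t} →
  Exec (pushD c) (memory o u v d t []) (1 + c * 2) (memory o u v (replicate c true ++ d) t [])
Exec-pushD zero    = skip
Exec-pushD (suc c) = slack (≤-reflexive (lemma c)) (Exec-pushD c ⨾ push)
  where
  lemma : ∀ c → 1 + c * 2 + 2 ≡ 1 + suc c * 2
  lemma = solve-∀

dupD : Prog 6
dupD = loop D (λ b → push (slot C) b ⨾ push (slot T) b)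

Exec-dupD : ∀ d {o u c t} →
  Exec dupD (memory o u c d t []) (length d * 5 + 1) (memory o u (d ʳ++ c) [] (d ʳ++ t) [])
Exec-dupD []      = loop-done refl
Exec-dupD (_ ∷ d) = loop-next refl (push ⨾ push) (Exec-dupD d)

module _ (c k : ℕ) where

  -- T starts with height 1, the empty product. Each unit of the power then adds c to D, a last c
  -- gives the constant term, and `dupD` copies the result to C and T, since the same number bounds
  -- cells and times.
  count : Prog 6
  count = push (slot T) true ⨾ powTX k ⨾ loop (slot T) (λ _ → pushD c) ⨾ pushD c ⨾ dupD

  timeCount : ℕ → ℕ
  timeCount n = 2 + (timePowTX k n 1 + ((n ^ k * (2 + c * 2) + 1) + ((1 + c * 2) + (polyBound c k n * 5 + 1))))

  Exec-count : ∀ u {o} → ∃[ v ] length v ≡ polyBound c k (length u) ×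
    Exec count (memory o u [] [] [] []) (timeCount (length u)) (memory o u v [] v [])
  Exec-count u {o} with Exec-powTX k (true ∷ []) {o} {u} {[]}
  ... | t , l , e = reverse d , trans (length-reverse d) length-d ,
    (push ⨾ e ⨾ retime (cong (λ n → n * (2 + c * 2) + 1) length-t) (scale t []) ⨾ Exec-pushD c ⨾
     retime (cong (λ n → n * 5 + 1) length-d) (Exec-dupD d))
    where
    length-t : length t ≡ length u ^ k
    length-t = trans l (+-identityʳ _)
    scaled : List Bool → List Bool → List Bool
    scaled []      d = d
    scaled (_ ∷ t) d = scaled t (replicate c true ++ d)
    scale : ∀ t d → Exec (loop (slot T) (λ _ → pushD c)) (memory o u [] d t []) (length t * (2 + c * 2) + 1)
                      (memory o u [] (scaled t d) [] [])
    scale []      d = loop-done refl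
    scale (_ ∷ t) d = retime (sym (+-assoc (2 + c * 2) (length t * (2 + c * 2)) 1))
                        (loop-next refl (Exec-pushD c) (scale t _))
    length-pushed : ∀ d → length (replicate c true ++ d) ≡ c + length d
    length-pushed d = trans (length-++ (replicate c true)) (cong (_+ length d) (length-replicate c))
    length-scaled : ∀ t d → length (scaled t d) ≡ length t * c + length d
    length-scaled []      d = refl
    length-scaled (_ ∷ t) d = trans (length-scaled t _)
      (trans (cong (length t * c +_) (length-pushed d)) (lemma (length t * c) c (length d)))
      where
      lemma : ∀ p q r → p + (q + r) ≡ q + p + r
      lemma = solve-∀
    d = replicate c true ++ scaled t []
    length-d : length d ≡ polyBound c k (length u)
    length-d = trans (length-pushed (scaled t [])) (trans (cong (c +_) (length-scaled t []))
      (trans (cong (λ n → c + (n * c + 0)) length-t) (lemma c (length u ^ k))))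
      where
      lemma : ∀ c p → c + (p * c + 0) ≡ c * p + c
      lemma = solve-∀

-- Printing families of hypotheses

encodeHypotheses-++ : ∀ Γ Δ o → encodeHypotheses (Γ ++ Δ) o ≡ encodeHypotheses Γ (encodeHypotheses Δ o)
encodeHypotheses-++ []      Δ o = refl
encodeHypotheses-++ (α ∷ Γ) Δ o = cong (λ w → false ∷ true ∷ true ∷ encode α ++ w) (encodeHypotheses-++ Γ Δ o)

encode-hypotheses : ∀ Γ γ → encode (foldr _⇒_ γ Γ) ≡ encodeHypotheses Γ (encode γ)
encode-hypotheses []      γ = refl
encode-hypotheses (α ∷ Γ) γ = cong (λ w → false ∷ true ∷ true ∷ encode α ++ w) (encode-hypotheses Γ γ)

-- The bits popped from C are saved on D, from which `emitGrid` refills C before the next time.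
emitRow : List Template → Prog 6
emitRow as = loop (slot C) (λ b → push D b ⨾ emitHypotheses as)

emitGrid : List Template → Prog 6
emitGrid as = loop (slot T) (λ _ → emitRow as ⨾ loop D (push (slot C)))

emitBits : (Bool → List Template) → Prog 6
emitBits as = loop (slot X) (λ b → emitHypotheses (as b))

row : List Template → (n t i : ℕ) → List Formula
row as n t = gather (λ i → List.map (instantiate (heights n i t)) as)

grid : List Template → (n i t : ℕ) → List Formula
grid as n i = gather (λ t → row as n t i)

bitFacts : (Bool → List Template) → List Bool → List Formula
bitFacts as = gatherBits (λ n b → List.map (instantiate (heights n 0 0)) (as b))

module _ (B : ℕ) where

  timeRow timeGrid : List Template → ℕ → ℕ
  timeRow as i  = i * (3 + timeHypotheses B as) + 1
  timeGrid as i = i * suc (timeRow as i + (i * 3 + 1)) + 1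

  timeBits : (Bool → List Template) → ℕ → ℕ
  timeBits as n = n * suc (timeHypotheses B (as false) + timeHypotheses B (as true)) + 1

module _ {B : ℕ} where

  heights-bounded : ∀ {n i t} → n ≤ B → i ≤ B → t ≤ B → ∀ r → heights n i t r ≤ B
  heights-bounded n≤ i≤ t≤ X = n≤
  heights-bounded n≤ i≤ t≤ C = i≤
  heights-bounded n≤ i≤ t≤ T = t≤

  Exec-emitRow : ∀ as {u} c {t o d} → length u ≤ B → length c ≤ B → length t ≤ B →
    Exec (emitRow as) (memory o u c d t []) (timeRow B as (length c))
      (memory (encodeHypotheses (row as (length u) (length t) (length c)) o) u [] (c ʳ++ d) t [])
  Exec-emitRow as []      _  _  _  = loop-done refl
  Exec-emitRow as {u} (b ∷ c) {t} {o} {d} u≤ c≤ t≤ =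
    subst (λ w → Exec (emitRow as) (memory o u (b ∷ c) d t []) (timeRow B as (suc (length c)))
                   (memory w u [] (c ʳ++ b ∷ d) t []))
      (sym (encodeHypotheses-++ (row as (length u) (length t) (length c)) _ o))
      (retime (sym (+-assoc (3 + timeHypotheses B as) (length c * (3 + timeHypotheses B as)) 1))
        (loop-next refl
          (push ⨾ Exec-emitHypotheses (contents u c t) (contents-heights u c t)
                    (heights-bounded u≤ (<⇒≤ c≤) t≤) as)
          (Exec-emitRow as c u≤ (<⇒≤ c≤) t≤)))

  Exec-emitGrid : ∀ as {u c} t {o n} → length c ≡ n → length u ≤ B → n ≤ B → length t ≤ B →
    Exec (emitGrid as) (memory o u c [] t [])
      (length t * suc (timeRow B as n + (n * 3 + 1)) + 1)
      (memory (encodeHypotheses (grid as (length u) n (length t)) o) u c [] [] [])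
  Exec-emitGrid as []      _  _  _  _  = loop-done refl
  Exec-emitGrid as {u} {c} (b ∷ t) {o} refl u≤ c≤ t≤ =
    subst (λ w → Exec (emitGrid as) (memory o u c [] (b ∷ t) []) (suc (length t) * suc each + 1)
                   (memory w u c [] [] []))
      (sym (encodeHypotheses-++ (grid as (length u) (length c) (length t)) _ o))
      (retime (sym (+-assoc (suc each) (length t * suc each) 1))
        (loop-next refl
          (Exec-emitRow as c u≤ c≤ (<⇒≤ t≤) ⨾
           subst (λ v → Exec (loop D (push (slot C)))
                          (memory (encodeHypotheses (row as (length u) (length t) (length c)) o) u [] (reverse c) t [])
                          (length c * 3 + 1)
                          (memory (encodeHypotheses (row as (length u) (length t) (length c)) o) u v [] t []))
             (reverse-involutive c)
             (retime (cong (λ n → n * 3 + 1) (length-reverse c)) (Exec-moveDC (reverse c))))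
          (Exec-emitGrid as t refl u≤ c≤ (<⇒≤ t≤))))
    where
    each = timeRow B as (length c) + (length c * 3 + 1)

  Exec-emitBits : ∀ as u {o d} → length u ≤ B →
    Exec (emitBits as) (memory o u [] d [] []) (timeBits B as (length u))
      (memory (encodeHypotheses (bitFacts as u) o) [] [] d [] [])
  Exec-emitBits as []      _  = loop-done refl
  Exec-emitBits as (b ∷ u) {o} {d} u≤ =
    subst (λ w → Exec (emitBits as) (memory o (b ∷ u) [] d [] []) (suc (length u) * suc each + 1)
                   (memory w [] [] d [] []))
      (sym (encodeHypotheses-++ (bitFacts as u) _ o))
      (retime (sym (+-assoc (suc each) (length u * suc each) 1))
        (loop-next refl
          (slack (each≥ b)
            (Exec-emitHypotheses (contents u [] []) (contents-heights u [] [])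
              (heights-bounded (<⇒≤ u≤) z≤n z≤n) (as b)))
          (Exec-emitBits as u (<⇒≤ u≤))))
    where
    each = timeHypotheses B (as false) + timeHypotheses B (as true)
    each≥ : ∀ b → timeHypotheses B (as b) ≤ each
    each≥ false = m≤m+n _ _
    each≥ true  = m≤n+m _ (timeHypotheses B (as false))

Exec-load : ∀ x {u} →
  Exec (loop O (push (slot X))) (memory x u [] [] [] []) (length x * 3 + 1) (memory [] (x ʳ++ u) [] [] [] [])
Exec-load []      = loop-done refl
Exec-load (_ ∷ x) = loop-next refl push (Exec-load x)

-- Polynomial bounds on the printing times

private
  infixl 6 _+ᵖ_
  infixl 7 _*ᵖ_
  _+ᵖ_ : ∀ {f g} → PolyBounded f → PolyBounded g → PolyBounded (λ n → f n + g n)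
  _+ᵖ_ = PolyBounded-+
  _*ᵖ_ : ∀ {f g} → PolyBounded f → PolyBounded g → PolyBounded (λ n → f n * g n)
  _*ᵖ_ = PolyBounded-*
  #ᵖ : ∀ c → PolyBounded (λ _ → c)
  #ᵖ = PolyBounded-const

-- The height of T grows by a factor n in each round, so the induction needs an arbitrary
-- polynomially bounded initial height.
PolyBounded-timePowTX : ∀ j {f} → PolyBounded f → PolyBounded (λ n → timePowTX j n (f n))
PolyBounded-timePowTX zero    f = #ᵖ 1
PolyBounded-timePowTX (suc j) f =
  f *ᵖ (#ᵖ 1 +ᵖ (PolyBounded-id *ᵖ #ᵖ 5 +ᵖ #ᵖ 1 +ᵖ (PolyBounded-id *ᵖ #ᵖ 3 +ᵖ #ᵖ 1))) +ᵖ #ᵖ 1 +ᵖ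
  (f *ᵖ PolyBounded-id *ᵖ #ᵖ 3 +ᵖ #ᵖ 1) +ᵖ PolyBounded-timePowTX j (f *ᵖ PolyBounded-id)

module _ {B : ℕ → ℕ} (b : PolyBounded B) where

  PolyBounded-timeIndex : ∀ i → PolyBounded (λ n → timeIndex (B n) i)
  PolyBounded-timeIndex (# n)   = #ᵖ (n * 4 + 1)
  PolyBounded-timeIndex (ht r)  = b *ᵖ #ᵖ 7 +ᵖ #ᵖ 1 +ᵖ (b *ᵖ #ᵖ 3 +ᵖ #ᵖ 1)
  PolyBounded-timeIndex (1+ i)  = #ᵖ 4 +ᵖ PolyBounded-timeIndex i
  PolyBounded-timeIndex (i ⊕ j) = PolyBounded-timeIndex i +ᵖ PolyBounded-timeIndex j

  PolyBounded-time : ∀ a → PolyBounded (λ n → time (B n) a)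
  PolyBounded-time (atom t i ns) =
    #ᵖ (timeFields ns) +ᵖ (#ᵖ 4 +ᵖ (PolyBounded-timeIndex i +ᵖ (#ᵖ 4 +ᵖ (PolyBounded-timeIndex t +ᵖ #ᵖ 6))))
  PolyBounded-time (a₁ ⊃ a₂) = PolyBounded-time a₂ +ᵖ (PolyBounded-time a₁ +ᵖ #ᵖ 6)
  PolyBounded-time (a₁ ⊔ a₂) = PolyBounded-time a₂ +ᵖ (PolyBounded-time a₁ +ᵖ #ᵖ 6)

  PolyBounded-timeHypotheses : ∀ as → PolyBounded (λ n → timeHypotheses (B n) as)
  PolyBounded-timeHypotheses []       = #ᵖ 1
  PolyBounded-timeHypotheses (a ∷ as) =
    PolyBounded-timeHypotheses as +ᵖ (PolyBounded-time a +ᵖ #ᵖ 6)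

-- The generator of the formula

module Generator (goal start : Template) (rules blanks : List Template)
                 (facts : Bool → List Template) where

  hypotheses : List Bool → (n N : ℕ) → List Formula
  hypotheses u n N =
    instantiate (heights 0 0 0) start ∷ (bitFacts facts u ++ (row blanks n 0 N ++ grid rules n N N))

  conclusion : (n N : ℕ) → Formula
  conclusion n N = instantiate (heights n N N) goal

  -- The conclusion comes first, then the hypotheses from last to first. Each phase may destroy a
  -- counter that later ones do without: the grid uses up T, the row of blanks C, and the input bits
  -- X.
  emission : Prog 6
  emission = emit goal ⨾ emitGrid rules ⨾ emitRow blanks ⨾ emitBits facts ⨾ emitHypotheses (start ∷ [])

  timeEmission : (n N : ℕ) → ℕ
  timeEmission n N = let B = n + N in
    time B goal + (timeGrid B rules N + (timeRow B blanks N +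
    (timeBits B facts n + timeHypotheses B (start ∷ []))))

  Exec-emission : ∀ u v {n N} → length u ≡ n → length v ≡ N →
    Exec emission (memory [] u v [] v []) (timeEmission n N)
      (memory (encode (foldr _⇒_ (conclusion n N) (hypotheses u n N))) [] [] (reverse v) [] [])
  Exec-emission u v {n} {N} refl refl =
    subst (λ w → Exec emission (memory [] u v [] v []) (timeEmission n N)
                   (memory w [] [] (reverse v) [] []))
      (sym output≡)
      (subst (λ w → Exec (emit goal) (memory [] u v [] v []) (time B goal) (memory w u v [] v []))
         (++-identityʳ (encode (conclusion n N)))
         (Exec-emit (contents u v v) (contents-heights u v v) (heights-bounded n≤ N≤ N≤) goal) ⨾
       Exec-emitGrid rules v refl n≤ N≤ N≤ ⨾
       Exec-emitRow blanks v n≤ N≤ z≤n ⨾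
       Exec-emitBits facts u n≤ ⨾
       Exec-emitHypotheses (contents [] [] []) (contents-heights [] [] [])
         (heights-bounded z≤n z≤n z≤n) (start ∷ []))
    where
    B = n + N
    n≤ : n ≤ B
    n≤ = m≤m+n n N
    N≤ : N ≤ B
    N≤ = m≤n+m N n
    output≡ : encode (foldr _⇒_ (conclusion n N) (hypotheses u n N)) ≡
      encodeHypotheses (instantiate (heights 0 0 0) start ∷ [])
        (encodeHypotheses (bitFacts facts u) (encodeHypotheses (row blanks n 0 N)
          (encodeHypotheses (grid rules n N N) (encode (conclusion n N)))))
    output≡ = trans (encode-hypotheses (hypotheses u n N) (conclusion n N))
      (cong (encodeHypotheses (instantiate (heights 0 0 0) start ∷ []))
        (trans (encodeHypotheses-++ (bitFacts facts u) _ _)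
          (cong (encodeHypotheses (bitFacts facts u))
            (encodeHypotheses-++ (row blanks n 0 N) _ _))))

  module _ (c k : ℕ) where

    -- Moving the input to X reverses it. The bit at position i of x then lies on exactly i others,
    -- so the height of X after popping it is its cell.
    formula : List Bool → Formula
    formula x = let n = length x; N = polyBound c k n in
      foldr _⇒_ (conclusion n N) (hypotheses (reverse x) n N)

    generator : Prog 6
    generator = loop O (push (slot X)) ⨾ count c k ⨾ emission

    timeGenerator : ℕ → ℕ
    timeGenerator n = (n * 3 + 1) + (timeCount c k n + timeEmission n (polyBound c k n))

    Exec-generator : ∀ x → ∃[ d ]
      Exec generator (memory x [] [] [] [] []) (timeGenerator (length x))
        (memory (encode (formula x)) [] [] d [] [])
    Exec-generator x with Exec-count c k (reverse x) {[]}
    ... | v , length-v , e = reverse v ,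
      (Exec-load x ⨾ retime (cong (timeCount c k) (length-reverse x)) e ⨾
       Exec-emission (reverse x) v (length-reverse x)
         (trans length-v (cong (polyBound c k) (length-reverse x))))

    PolyBounded-timeGenerator : PolyBounded timeGenerator
    PolyBounded-timeGenerator =
      (PolyBounded-id *ᵖ #ᵖ 3 +ᵖ #ᵖ 1) +ᵖ
      (#ᵖ 2 +ᵖ
        (PolyBounded-timePowTX k (#ᵖ 1) +ᵖ
          (PolyBounded-^ k *ᵖ #ᵖ (2 + c * 2) +ᵖ #ᵖ 1 +ᵖ (#ᵖ (1 + c * 2) +ᵖ (N *ᵖ #ᵖ 5 +ᵖ #ᵖ 1)))) +ᵖ
       (PolyBounded-time B goal +ᵖ
         (N *ᵖ (#ᵖ 1 +ᵖ (timeRowᵖ rules +ᵖ (N *ᵖ #ᵖ 3 +ᵖ #ᵖ 1))) +ᵖ #ᵖ 1 +ᵖ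
           (timeRowᵖ blanks +ᵖ
             (PolyBounded-id *ᵖ
                (#ᵖ 1 +ᵖ (PolyBounded-timeHypotheses B (facts false) +ᵖ
                          PolyBounded-timeHypotheses B (facts true))) +ᵖ #ᵖ 1 +ᵖ
              PolyBounded-timeHypotheses B (start ∷ []))))))
      where
      N : PolyBounded (polyBound c k)
      N = poly c k λ _ → ≤-refl
      B : PolyBounded (λ n → n + polyBound c k n)
      B = PolyBounded-id +ᵖ N
      timeRowᵖ : ∀ as → PolyBounded (λ n → timeRow (n + polyBound c k n) as (polyBound c k n))
      timeRowᵖ as = N *ᵖ (#ᵖ 3 +ᵖ PolyBounded-timeHypotheses B as) +ᵖ #ᵖ 1

    PolyTime-formula : PolyTime (λ x → encode (formula x))
    PolyTime-formula =
      Exec⇒PolyTime generator (λ x → encode (formula x)) PolyBounded-timeGenerator λ x →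
        ([] ∷ [] ∷ proj₁ (Exec-generator x) ∷ [] ∷ [] ∷ []) , proj₂ (Exec-generator x)

-- Derivability from hypotheses

infix 3 _⊩_

-- `R¬` and `R∘` enter only through `theorem`. Under hypotheses there is modus ponens alone, which
-- is why the deduction theorem holds.
data _⊩_ (Γ : List Formula) : Formula → Set where
  theorem : ∀ {φ} → ⊢ φ → Γ ⊩ φ
  hyp     : ∀ {φ} → φ ∈ Γ → Γ ⊩ φ
  app     : ∀ {φ ψ} → Γ ⊩ φ ⇒ ψ → Γ ⊩ φ → Γ ⊩ ψ

weaken : ∀ {Γ Δ φ} → Γ ⊆ Δ → Γ ⊩ φ → Δ ⊩ φ
weaken Γ⊆Δ (theorem p) = theorem p
weaken Γ⊆Δ (hyp i)     = hyp (Γ⊆Δ i)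
weaken Γ⊆Δ (app p q)   = app (weaken Γ⊆Δ p) (weaken Γ⊆Δ q)

deduction : ∀ {Γ φ ψ} → φ ∷ Γ ⊩ ψ → Γ ⊩ φ ⇒ ψ
deduction (theorem p)             = app (theorem (K _ _)) (theorem p)
deduction {φ = φ} (hyp (here refl)) =
  app (app (theorem (S _ _ _)) (theorem (K _ _))) (theorem (K φ φ))
deduction (hyp (there i))         = app (theorem (K _ _)) (hyp i)
deduction (app p q)               = app (app (theorem (S _ _ _)) (deduction p)) (deduction q)

∨-elim : ∀ {Γ φ ψ χ} → Γ ⊩ φ ∨ ψ → φ ∷ Γ ⊩ χ → ψ ∷ Γ ⊩ χ → Γ ⊩ χ
∨-elim p q r = app (app (app (theorem (∨-E _ _ _)) (deduction q)) (deduction r)) p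

⊩⇒⊢ : ∀ {φ} → [] ⊩ φ → ⊢ φ
⊩⇒⊢ (theorem p) = p
⊩⇒⊢ (app p q)   = mp (⊩⇒⊢ q) (⊩⇒⊢ p)

-- Successive deductions build up Γ in reverse. Asking for a derivation from every larger Θ hides
-- the order of the context.
discharge : ∀ Γ {Δ φ} → (∀ {Θ} → Γ ⊆ Θ → Δ ⊆ Θ → Θ ⊩ φ) → Δ ⊩ foldr _⇒_ φ Γ
discharge []      p = p (λ ()) (λ i → i)
discharge (γ ∷ Γ) p = deduction (discharge Γ λ Γ⊆Θ γΔ⊆Θ →
  p (λ { (here refl) → γΔ⊆Θ (here refl) ; (there i) → Γ⊆Θ i }) (λ i → γΔ⊆Θ (there i)))

discharge-all : ∀ Γ {φ} → (∀ {Θ} → Γ ⊆ Θ → Θ ⊩ φ) → ⊢ foldr _⇒_ φ Γ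
discharge-all Γ p = ⊩⇒⊢ (discharge Γ λ Γ⊆Θ _ → p Γ⊆Θ)

-- Classical semantics with ∘ read as truth.  The double negations make every
-- formula stable, so valuations need not be decidable.
module Semantics (V : ℕ → Set) where

  ⟦_⟧ : Formula → Set
  ⟦ var i ⟧ = DoubleNegation (V i)
  ⟦ α ∧ β ⟧ = ⟦ α ⟧ × ⟦ β ⟧
  ⟦ α ∨ β ⟧ = DoubleNegation (⟦ α ⟧ ⊎ ⟦ β ⟧)
  ⟦ α ⇒ β ⟧ = ⟦ α ⟧ → ⟦ β ⟧
  ⟦ ¬ α ⟧   = ⟦ α ⟧ → ⊥
  ⟦ ∘ α ⟧   = ⊤

  stable : ∀ φ → DoubleNegation ⟦ φ ⟧ → ⟦ φ ⟧
  stable (var i) p    = λ k → p λ q → q k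
  stable (α ∧ β) p    = stable α (λ k → p λ q → k (proj₁ q)) , stable β (λ k → p λ q → k (proj₂ q))
  stable (α ∨ β) p    = λ k → p λ q → q k
  stable (α ⇒ β) p a  = stable β λ k → p λ f → k (f a)
  stable (¬ α)   p a  = p λ f → f a
  stable (∘ α)   p    = tt

  -- Since formulas are stable, a doubly negated premise can be opened while one is being proved.
  bind : ∀ {A : Set} φ → DoubleNegation A → (A → ⟦ φ ⟧) → ⟦ φ ⟧
  bind φ a f = stable φ λ k → a λ x → k (f x)

  sound : ∀ {φ} → ⊢ φ → ⟦ φ ⟧
  sound (K α β)           = λ a _ → a
  sound (S α β γ)         = λ f g a → f a (g a)
  sound (∧-I α β)         = _,_
  sound (∧-E₁ α β)        = proj₁
  sound (∧-E₂ α β)        = proj₂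
  sound (∨-I₁ α β)        = λ a k → k (inj₁ a)
  sound (∨-I₂ α β)        = λ b k → k (inj₂ b)
  sound (∨-E α β γ) f g p = bind γ p λ { (inj₁ a) → f a ; (inj₂ b) → g b }
  sound (⇒-∨ α β)         = λ k → k (inj₁ λ a → ⊥-elim (k (inj₂ a)))
  sound (em α)            = λ k → k (inj₂ λ a → k (inj₁ a))
  sound (bc α β)          = λ _ a n → ⊥-elim (n a)
  sound (mp p q)          = sound q (sound p)
  sound (R¬ p)            = (λ n b → n (proj₂ (sound p) b)) , (λ n a → n (proj₁ (sound p) a))
  sound (R∘ p)            = _

  apply-all : ∀ Γ {φ} → ⟦ foldr _⇒_ φ Γ ⟧ → All ⟦_⟧ Γ → ⟦ φ ⟧
  apply-all []      p []       = p
  apply-all (_ ∷ Γ) p (a ∷ as) = apply-all Γ (p a) as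

-- Injectivity of the encoding, by a parser bounded in depth

parseℕᵇ : List Bool → Maybe (ℕᵇ × List Bool)
parseℕᵇ (false ∷ w)        = just (zero , w)
parseℕᵇ (true ∷ false ∷ w) = Maybe.map (map₁ 1+[2_]) (parseℕᵇ w)
parseℕᵇ (true ∷ true ∷ w)  = Maybe.map (map₁ 2[1+_]) (parseℕᵇ w)
parseℕᵇ _                  = nothing

parseℕᵇ-encodeℕᵇ : ∀ b {w} → parseℕᵇ (encodeℕᵇ b ++ w) ≡ just (b , w)
parseℕᵇ-encodeℕᵇ zero     = refl
parseℕᵇ-encodeℕᵇ 1+[2 b ] = cong (Maybe.map (map₁ 1+[2_])) (parseℕᵇ-encodeℕᵇ b)
parseℕᵇ-encodeℕᵇ 2[1+ b ] = cong (Maybe.map (map₁ 2[1+_])) (parseℕᵇ-encodeℕᵇ b)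

Parser : Set
Parser = List Bool → Maybe (Formula × List Bool)

parse₂ : (Formula → Formula → Formula) → Parser → Parser
parse₂ _∙_ p w = p w >>= λ (α , w′) → Maybe.map (map₁ (α ∙_)) (p w′)

parse : ℕ → Parser
parse (suc d) (false ∷ false ∷ false ∷ w) = Maybe.map (map₁ (var ∘′ toℕ₂)) (parseℕᵇ w)
parse (suc d) (false ∷ false ∷ true ∷ w)  = parse₂ _∧_ (parse d) w
parse (suc d) (false ∷ true ∷ false ∷ w)  = parse₂ _∨_ (parse d) w
parse (suc d) (false ∷ true ∷ true ∷ w)   = parse₂ _⇒_ (parse d) w
parse (suc d) (true ∷ false ∷ false ∷ w)  = Maybe.map (map₁ ¬_) (parse d w)
parse (suc d) (true ∷ false ∷ true ∷ w)   = Maybe.map (map₁ ∘_) (parse d w)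
parse _       _                           = nothing

depth : Formula → ℕ
depth (var _) = 1
depth (α ∧ β) = suc (depth α ℕ.⊔ depth β)
depth (α ∨ β) = suc (depth α ℕ.⊔ depth β)
depth (α ⇒ β) = suc (depth α ℕ.⊔ depth β)
depth (¬ α)   = suc (depth α)
depth (∘ α)   = suc (depth α)

parse₂-++ : ∀ _∙_ (p : Parser) u v {w α β} → p (u ++ v ++ w) ≡ just (α , v ++ w) → p (v ++ w) ≡ just (β , w) →
  parse₂ _∙_ p ((u ++ v) ++ w) ≡ just (α ∙ β , w)
parse₂-++ _∙_ p u v {w} eq eq′ rewrite ++-assoc u v w | eq | eq′ = refl

parse-encode : ∀ φ {d w} → depth φ ≤ d → parse d (encode φ ++ w) ≡ just (φ , w)
parse-encode (var i) {w = w} (s≤s _)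
  rewrite parseℕᵇ-encodeℕᵇ (fromℕ i) {w} | ℕᵇ.toℕ-fromℕ i = refl
parse-encode (α ∧ β) {suc d} (s≤s le) = parse₂-++ _∧_ (parse d) (encode α) (encode β)
  (parse-encode α (m⊔n≤o⇒m≤o _ _ le)) (parse-encode β (m⊔n≤o⇒n≤o (depth α) _ le))
parse-encode (α ∨ β) {suc d} (s≤s le) = parse₂-++ _∨_ (parse d) (encode α) (encode β)
  (parse-encode α (m⊔n≤o⇒m≤o _ _ le)) (parse-encode β (m⊔n≤o⇒n≤o (depth α) _ le))
parse-encode (α ⇒ β) {suc d} (s≤s le) = parse₂-++ _⇒_ (parse d) (encode α) (encode β)
  (parse-encode α (m⊔n≤o⇒m≤o _ _ le)) (parse-encode β (m⊔n≤o⇒n≤o (depth α) _ le))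
parse-encode (¬ α) (s≤s le) = cong (Maybe.map (map₁ ¬_)) (parse-encode α le)
parse-encode (∘ α) (s≤s le) = cong (Maybe.map (map₁ ∘_)) (parse-encode α le)

encode-injective : ∀ {φ ψ} → encode φ ≡ encode ψ → φ ≡ ψ
encode-injective {φ} {ψ} eq = just-proj₁ (trans (sym (parse-encode φ {w = []} (m≤m⊔n (depth φ) (depth ψ))))
  (trans (cong (λ u → parse (depth φ ℕ.⊔ depth ψ) (u ++ [])) eq) (parse-encode ψ (m≤n⊔m (depth φ) (depth ψ)))))
  where
  just-proj₁ : ∀ {w w′ : List Bool} → just (φ , w) ≡ just (ψ , w′) → φ ≡ ψ
  just-proj₁ refl = refl

-- Injectivity of the naming of variables

-- `ones` adds its digits from the inside; injectivity needs one of them as the outermost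
-- constructor.
ones-suc : ∀ n b → ones (suc n) b ≡ 2[1+ ones n b ]
ones-suc zero    b = refl
ones-suc (suc n) b = ones-suc n 2[1+ b ]

ones-injective : ∀ m n {a b} → ones m 1+[2 a ] ≡ ones n 1+[2 b ] → m ≡ n × a ≡ b
ones-injective zero    zero    refl = refl , refl
ones-injective zero    (suc n) {b = b} eq with () ← trans eq (ones-suc n 1+[2 b ])
ones-injective (suc m) zero    {a} eq with () ← trans (sym (ones-suc m 1+[2 a ])) eq
ones-injective (suc m) (suc n) {a} {b} eq
  with ones-injective m n (2[1+]-injective (trans (sym (ones-suc m 1+[2 a ])) (trans eq (ones-suc n 1+[2 b ]))))
  where
  2[1+]-injective : ∀ {a b} → 2[1+ a ] ≡ 2[1+ b ] → a ≡ b
  2[1+]-injective refl = refl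
... | refl , a≡b = refl , a≡b

fields-injective : ∀ ms ns → fields ms ≡ fields ns → ms ≡ ns
fields-injective []       []       eq = refl
fields-injective []       (zero ∷ ns) ()
fields-injective []       (suc n ∷ ns) eq with () ← trans eq (ones-suc n 1+[2 fields ns ])
fields-injective (zero ∷ ms) []    ()
fields-injective (suc m ∷ ms) []   eq with () ← trans (sym (ones-suc m 1+[2 fields ms ])) eq
fields-injective (m ∷ ms) (n ∷ ns) eq with ones-injective m n eq
... | refl , eq′ = cong (m ∷_) (fields-injective ms ns eq′)

-- Membership in gathered lists and properties of all their entries

∈-gather : ∀ {A : Set} {f : ℕ → List A} {x i n} → i < n → x ∈ f i → x ∈ gather f n
∈-gather {f = f} {i = i} {suc n} i<1+n x∈ with m≤n⇒m<n∨m≡n (≤-pred i<1+n)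
... | inj₁ i<n  = ∈-++⁺ˡ (∈-gather i<n x∈)
... | inj₂ refl = ∈-++⁺ʳ (gather f n) x∈

All-gather : ∀ {A : Set} {P : A → Set} {f : ℕ → List A} → (∀ i → All P (f i)) → ∀ n → All P (gather f n)
All-gather ps zero    = []
All-gather ps (suc n) = All.++⁺ (All-gather ps n) (ps n)

∈-concatMap : ∀ {A B : Set} (f : A → List B) {x xs y} → x ∈ xs → y ∈ f x → y ∈ concatMap f xs
∈-concatMap f x∈ y∈ = ∈-concatMap⁺ f (lose x∈ y∈)

All-concatMap : ∀ {A B : Set} {P : B → Set} {f : A → List B} →
  (∀ x → All P (f x)) → ∀ xs → All P (concatMap f xs)
All-concatMap ps xs = All.concat⁺ (All.map⁺ (All.universal ps xs))

All-mapped : ∀ {A B : Set} {P : B → Set} {f : A → B} → (∀ x → P (f x)) → ∀ xs → All P (List.map f xs)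
All-mapped ps xs = All.map⁺ (All.universal ps xs)

-- Cells are counted from the head: L 0 is the cell left of it, R 0 the scanned one.
data Side : Set where
  L R : Side

-- Tape contents by distance from the head

module _ {A : Set} where

  nth : List (Symbol A) → ℕ → Symbol A
  nth []       i       = blank
  nth (s ∷ ss) zero    = s
  nth (s ∷ ss) (suc i) = nth ss i

  stream : Side → Tape A → ℕ → Symbol A
  stream L t i = nth (before t) i
  stream R t i = nth (scanned t ∷ after t) i

  stream-blankTape : ∀ s i → stream s blankTape i ≡ blank
  stream-blankTape L i       = refl
  stream-blankTape R zero    = refl
  stream-blankTape R (suc i) = refl

  stream-inputTape : ∀ x i → stream R (inputTape x) i ≡ nth (List.map bit x) i
  stream-inputTape []      zero    = refl
  stream-inputTape []      (suc i) = refl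
  stream-inputTape (b ∷ x) i       = refl

  before-inputTape : ∀ x i → stream L (inputTape x) i ≡ blank
  before-inputTape []      i = refl
  before-inputTape (b ∷ x) i = refl

  nth-beyond : ∀ x i → nth (List.map bit x) (length x + i) ≡ blank
  nth-beyond []      i = refl
  nth-beyond (b ∷ x) i = nth-beyond x i

  module _ {C : Set} {f : ℕ → Bool → List C} where

    gatherBits-ʳ++ : ∀ x w → gatherBits f w ⊆ gatherBits f (x ʳ++ w)
    gatherBits-ʳ++ []      w y∈ = y∈
    gatherBits-ʳ++ (b ∷ x) w y∈ = gatherBits-ʳ++ x (b ∷ w) (∈-++⁺ˡ y∈)

    -- Generalised over the accumulator w of the reversal: bit i of x comes to stand before
    -- `length w + i` others.
    ∈-gatherBits : ∀ x w {i} → i < length x → ∃[ b ] nth (List.map bit x) i ≡ bit b ×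
      f (length w + i) b ⊆ gatherBits f (x ʳ++ w)
    ∈-gatherBits (b ∷ x) w {zero} _ = b , refl , λ {y} y∈ →
      gatherBits-ʳ++ x (b ∷ w) (∈-++⁺ʳ (gatherBits f w)
        (subst (λ n → y ∈ f n b) (+-identityʳ (length w)) y∈))
    ∈-gatherBits (b ∷ x) w {suc i} (s≤s i<) with ∈-gatherBits x (b ∷ w) i<
    ... | b′ , eq , ⊆g = b′ , eq , λ {y} y∈ →
      ⊆g (subst (λ n → y ∈ f n b′) (+-suc (length w) i) y∈)

    All-gatherBits : ∀ {P : C → Set} x w → All P (gatherBits f w) →
      (∀ i b → nth (List.map bit x) i ≡ bit b → All P (f (length w + i) b)) →
      All P (gatherBits f (x ʳ++ w))
    All-gatherBits []          w ps qs = ps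
    All-gatherBits {P} (b ∷ x) w ps qs = All-gatherBits x (b ∷ w)
      (All.++⁺ ps (subst (λ n → All P (f n b)) (+-identityʳ (length w)) (qs 0 b refl)))
      (λ i b′ eq → subst (λ n → All P (f n b′)) (+-suc (length w) i) (qs (suc i) b′ eq))

-- Reaches every cell as the height of C varies.
data Offset : Set where
  first second further : Offset

offset : Offset → Index
offset first   = # 0
offset second  = # 1
offset further = 1+ (1+ ht C)

-- Rules are instantiated only for heights of C below N, so the height must be in range too. The
-- constant offsets ignore it and take 0.
offset-surjective : ∀ {n t N} j → j < N → ∃[ p ] ∃[ i ] i < N × eval (heights n i t) (offset p) ≡ j
offset-surjective zero          j< = first , 0 , j< , refl
offset-surjective (suc zero)    j< = second , 0 , <-trans (s≤s z≤n) j< , refl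
offset-surjective (suc (suc j)) j< = further , j , <-trans (n<1+n j) (<-trans (n<1+n (suc j)) j<) , refl

-- Where the content of a cell comes from when the head writes and moves;
-- `nothing` stands for the symbol that was written.
source : Move → Side → Offset → Maybe (Side × Index)
source stay  R first   = nothing
source stay  s p       = just (s , offset p)
source right R p       = just (R , 1+ offset p)
source right L first   = nothing
source right L second  = just (L , # 0)
source right L further = just (L , 1+ ht C)
source left  L p       = just (L , 1+ offset p)
source left  R first   = just (L , # 0)
source left  R second  = nothing
source left  R further = just (R , 1+ ht C)

module _ {A : Set} where

  before-right : ∀ (t : Tape A) → before (move right t) ≡ scanned t ∷ before t
  before-right ⟨ _ , _ , []    ⟩ = refl
  before-right ⟨ _ , _ , _ ∷ _ ⟩ = refl

  stream-right : ∀ (t : Tape A) i → stream R (move right t) i ≡ nth (after t) i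
  stream-right ⟨ _ , _ , []    ⟩ zero    = refl
  stream-right ⟨ _ , _ , []    ⟩ (suc i) = refl
  stream-right ⟨ _ , _ , _ ∷ _ ⟩ i       = refl

  after-left : ∀ (t : Tape A) → after (move left t) ≡ scanned t ∷ after t
  after-left ⟨ []    , _ , _ ⟩ = refl
  after-left ⟨ _ ∷ _ , _ , _ ⟩ = refl

  scanned-left : ∀ (t : Tape A) → scanned (move left t) ≡ nth (before t) 0
  scanned-left ⟨ []    , _ , _ ⟩ = refl
  scanned-left ⟨ _ ∷ _ , _ , _ ⟩ = refl

  stream-left : ∀ (t : Tape A) i → stream L (move left t) i ≡ nth (before t) (suc i)
  stream-left ⟨ []    , _ , _ ⟩ i = refl
  stream-left ⟨ _ ∷ _ , _ , _ ⟩ i = refl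

module _ (ρ : Register → ℕ) {A : Set} where

  sourced : Symbol A → Tape A → Maybe (Side × Index) → Symbol A
  sourced w t nothing        = w
  sourced w t (just (s , i)) = stream s t (eval ρ i)

  stream-writeMove : ∀ w m (t : Tape A) s p →
    stream s (writeMove (w , m) t) (eval ρ (offset p)) ≡ sourced w t (source m s p)
  stream-writeMove w stay  t L first   = refl
  stream-writeMove w stay  t L second  = refl
  stream-writeMove w stay  t L further = refl
  stream-writeMove w stay  t R first   = refl
  stream-writeMove w stay  t R second  = refl
  stream-writeMove w stay  t R further = refl
  stream-writeMove w right t R p       = stream-right ⟨ before t , w , after t ⟩ (eval ρ (offset p))
  stream-writeMove w right t L p rewrite before-right ⟨ before t , w , after t ⟩ with p
  ... | first   = refl
  ... | second  = refl
  ... | further = refl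
  stream-writeMove w left  t L p       = stream-left ⟨ before t , w , after t ⟩ (eval ρ (offset p))
  stream-writeMove w left  t R first   = scanned-left ⟨ before t , w , after t ⟩
  stream-writeMove w left  t R second  rewrite after-left ⟨ before t , w , after t ⟩ = refl
  stream-writeMove w left  t R further rewrite after-left ⟨ before t , w , after t ⟩ = refl

-- Numeric codes of finite types

bitCode : Bool → ℕ
bitCode false = 0
bitCode true  = 1

bitCode-injective : ∀ {b b′} → bitCode b ≡ bitCode b′ → b ≡ b′
bitCode-injective {false} {false} refl = refl
bitCode-injective {true}  {true}  refl = refl

sideCode : Side → ℕ
sideCode L = 0
sideCode R = 1

sideCode-injective : ∀ {s s′} → sideCode s ≡ sideCode s′ → s ≡ s′
sideCode-injective {L} {L} refl = refl
sideCode-injective {R} {R} refl = refl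

module _ {A : Set} {n : ℕ} (A↔Fin : A ↔ Fin n) where

  elements : List A
  elements = List.map (Inverse.from A↔Fin) (allFin n)

  ∈-elements : ∀ a → a ∈ elements
  ∈-elements a = subst (_∈ elements) (Inverse.strictlyInverseʳ A↔Fin a)
    (∈-map⁺ (Inverse.from A↔Fin) (∈-allFin (Inverse.to A↔Fin a)))

  index : A → ℕ
  index a = toℕ (Inverse.to A↔Fin a)

  index-injective : ∀ {a b} → index a ≡ index b → a ≡ b
  index-injective eq = Injection.injective (↔⇒↣ A↔Fin) (toℕ-injective eq)

-- The tableau of a machine

module Tableau (M : NTM) where

  open TM M hiding (start) renaming (workTapes to k)

  data Fact : Set where
    choice : Bool → Fact
    state  : Control State → Fact
    cell   : Side → Fin (suc k) → Symbol Aux → Fact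

  controlCode : Control State → ℕ
  controlCode accept      = 0
  controlCode reject      = 1
  controlCode (running q) = 2 + index (proj₂ finite-State) q

  controlCode-injective : ∀ {q q′} → controlCode q ≡ controlCode q′ → q ≡ q′
  controlCode-injective {accept}    {accept}    _  = refl
  controlCode-injective {reject}    {reject}    _  = refl
  controlCode-injective {running _} {running _} eq =
    cong running (index-injective (proj₂ finite-State) (suc-injective (suc-injective eq)))

  symbolCode : Symbol Aux → ℕ
  symbolCode blank   = 0
  symbolCode (bit b) = 1 + bitCode b
  symbolCode (aux a) = 3 + index (proj₂ finite-Aux) a

  symbolCode-injective : ∀ {y y′} → symbolCode y ≡ symbolCode y′ → y ≡ y′
  symbolCode-injective {blank}     {blank}     _  = refl
  symbolCode-injective {bit _}     {bit _}     eq = cong bit (bitCode-injective (suc-injective eq))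
  symbolCode-injective {bit false} {aux _}     ()
  symbolCode-injective {bit true}  {aux _}     ()
  symbolCode-injective {aux _}     {bit false} ()
  symbolCode-injective {aux _}     {bit true}  ()
  symbolCode-injective {aux _}     {aux _}     eq =
    cong aux (index-injective (proj₂ finite-Aux) (suc-injective (suc-injective (suc-injective eq))))

  -- Side codes coincide with the tags of `choice` and `state`, but only cells have three fields.
  code : Fact → List ℕ
  code (choice b)   = 0 ∷ bitCode b ∷ []
  code (state q)    = 1 ∷ controlCode q ∷ []
  code (cell s j y) = sideCode s ∷ toℕ j ∷ symbolCode y ∷ []

  code-injective : ∀ {a a′} → code a ≡ code a′ → a ≡ a′
  code-injective {choice _} {choice _} eq =
    cong choice (bitCode-injective (∷-injectiveˡ (∷-injectiveʳ eq)))
  code-injective {state _} {state _} eq =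
    cong state (controlCode-injective (∷-injectiveˡ (∷-injectiveʳ eq)))
  code-injective {cell s j y} {cell s′ j′ y′} eq
    with sideCode-injective {s} {s′} (∷-injectiveˡ eq)
       | toℕ-injective {i = j} {j′} (∷-injectiveˡ (∷-injectiveʳ eq))
       | symbolCode-injective {y} {y′} (∷-injectiveˡ (∷-injectiveʳ (∷-injectiveʳ eq)))
  ... | refl | refl | refl = refl

  name : Fact → (t i : ℕ) → Formula
  name a t i = var (toℕ₂ (fields (t ∷ i ∷ code a)))

  at : Fact → (t i : Index) → Template
  at a t i = atom t i (code a)

  now next : Fact → Index → Template
  now  a i = at a (ht T) i
  next a i = at a (1+ (ht T)) i

  symbols : List (Symbol Aux)
  symbols = blank ∷ bit false ∷ bit true ∷ List.map aux (elements (proj₂ finite-Aux))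

  ∈-symbols : ∀ y → y ∈ symbols
  ∈-symbols blank       = here refl
  ∈-symbols (bit false) = there (here refl)
  ∈-symbols (bit true)  = there (there (here refl))
  ∈-symbols (aux a)     = there (there (there (∈-map⁺ aux (∈-elements (proj₂ finite-Aux) a))))

  words : ∀ n → List (Vec (Symbol Aux) n)
  words zero    = [] ∷ []
  words (suc n) = cartesianProductWith _∷_ symbols (words n)

  ∈-words : ∀ {n} (σ : Vec (Symbol Aux) n) → σ ∈ words n
  ∈-words []      = here refl
  ∈-words (y ∷ σ) = ∈-cartesianProductWith⁺ _∷_ (∈-symbols y) (∈-words σ)

  Word : Set
  Word = Vec (Symbol Aux) (suc k)

  scans : List (Fin (suc k)) → Word → Template → Template
  scans js σ a = foldr (λ j a → now (cell R j (lookup σ j)) (# 0) ⊃ a) a js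

  given : Bool → State → Word → Template → Template
  given b q σ a = now (choice b) (# 0) ⊃ now (state (running q)) (# 0) ⊃ scans (allFin (suc k)) σ a

  -- A written cell is known outright. A copied one takes a clause for each symbol, as a clause
  -- cannot quantify over symbols.
  sourceRules : Fin (suc k) → Symbol Aux → Maybe (Side × Index) → Side → Offset → List Template
  sourceRules j w nothing         s p = next (cell s j w) (offset p) ∷ []
  sourceRules j w (just (s′ , i)) s p =
    List.map (λ y → now (cell s′ j y) i ⊃ next (cell s j y) (offset p)) symbols

  cellRules : Fin (suc k) → Symbol Aux × Move → Side → Offset → List Template
  cellRules j (w , m) s p = sourceRules j w (source m s p) s p

  sides : List Side
  sides = L ∷ R ∷ []

  offsets : List Offset
  offsets = first ∷ second ∷ further ∷ []

  ∈-sides : ∀ s → s ∈ sides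
  ∈-sides L = here refl
  ∈-sides R = there (here refl)

  ∈-offsets : ∀ p → p ∈ offsets
  ∈-offsets first   = here refl
  ∈-offsets second  = there (here refl)
  ∈-offsets further = there (there (here refl))

  tapeRules : Vec (Symbol Aux × Move) (suc k) → Fin (suc k) → List Template
  tapeRules acts j = concatMap (λ s → concatMap (cellRules j (lookup acts j) s) offsets) sides

  effects : Control State × Vec (Symbol Aux × Move) (suc k) → List Template
  effects (q′ , acts) =
    next (state q′) (# 0) ∷
    concatMap (tapeRules acts) (allFin (suc k))

  stepRules : Bool → State → Word → List Template
  stepRules b q σ = List.map (given b q σ) (effects (δ b q σ))

  choiceRules : Bool → List Template
  choiceRules b = concatMap (λ q → concatMap (stepRules b q) (words (suc k))) (elements (proj₂ finite-State))

  -- The disjunction of the choices is the only rule that is not a Horn clause. After halting, only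
  -- the state is carried on, because the cells can no longer influence it.
  rules : List Template
  rules =
    (now (choice true) (# 0) ⊔ now (choice false) (# 0)) ∷
    (now (state accept) (# 0) ⊃ next (state accept) (# 0)) ∷
    (now (state reject) (# 0) ⊃ next (state reject) (# 0)) ∷
    concatMap choiceRules (true ∷ false ∷ [])

  -- When the goal is printed, C still has the height N, so `ht C` is the final time.
  goal start : Template
  goal  = at (state reject) (ht C) (# 0)
  start = at (state (running (TM.start M))) (# 0) (# 0)

  -- To the right on the first tape, blanks begin only behind the input, whose length is the height
  -- of X.
  blankIndex : Side → Fin (suc k) → Index
  blankIndex R zero = ht X ⊕ ht C
  blankIndex _ _    = ht C

  blankRule : Side → Fin (suc k) → Template
  blankRule s j = at (cell s j blank) (# 0) (blankIndex s j)

  blanks : List Template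
  blanks = concatMap (λ s → List.map (blankRule s) (allFin (suc k))) sides

  facts : Bool → List Template
  facts b = at (cell R zero (bit b)) (# 0) (ht X) ∷ []

-- A provable formula excludes accepting runs

module _ (M : NTM) where

  open TM M using (State; Aux; δ) renaming (workTapes to k)
  open Tableau M
  open Generator goal start rules blanks facts

  scanned-ext : ∀ {n} (ts : Vec (Tape Aux) n) σ → (∀ j → scanned (lookup ts j) ≡ lookup σ j) →
    Vec.map scanned ts ≡ σ
  scanned-ext ts σ eq = trans (sym (tabulate∘lookup (Vec.map scanned ts)))
    (trans (tabulate-cong λ j → trans (lookup-map j scanned ts) (eq j)) (tabulate∘lookup σ))

  step-running : ∀ {b q σ} (c : Config M) → control c ≡ running q → Vec.map scanned (tapes c) ≡ σ →
    step M b c ≡ config (proj₁ (δ b q σ)) (Vec.zipWith writeMove (proj₂ (δ b q σ)) (tapes c))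
  step-running (config _ ts) refl refl = refl

  initial-blank : ∀ x s j i → (s ≡ R → j ≡ zero → length x ≤ i) →
    stream s (lookup (tapes (initial M x)) j) i ≡ blank
  initial-blank x L zero    i _ = before-inputTape x i
  initial-blank x R zero    i far = trans (stream-inputTape x i)
    (subst (λ i → nth (List.map bit x) i ≡ blank) (m+[n∸m]≡n (far refl refl)) (nth-beyond x _))
  initial-blank x s (suc j) i _ =
    trans (cong (λ t → stream s t i) (lookup-replicate j blankTape)) (stream-blankTape s i)

  -- Unlike `run`, which peels off the first choice, this unfolds at the last step, so that
  -- consecutive times are related by `step` definitionally.
  trajectory : (ℕ → Bool) → Config M → ℕ → Config M
  trajectory ch c zero    = c
  trajectory ch c (suc t) = step M (ch t) (trajectory ch c t)

  trajectory-suc : ∀ ch c t →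
    trajectory ch c (suc t) ≡ trajectory (ch ∘′ suc) (step M (ch 0) c) t
  trajectory-suc ch c zero    = refl
  trajectory-suc ch c (suc t) = cong (step M (ch (suc t))) (trajectory-suc ch c t)

  choices : ∀ {n} → Vec Bool n → ℕ → Bool
  -- An arbitrary value: the configuration at time n depends on the first n choices only.
  choices []       t       = false
  choices (b ∷ bs) zero    = b
  choices (b ∷ bs) (suc t) = choices bs t

  run-trajectory : ∀ {n} (bs : Vec Bool n) c → run M bs c ≡ trajectory (choices bs) c n
  run-trajectory []       c = refl
  run-trajectory {suc n} (b ∷ bs) c =
    trans (run-trajectory bs (step M b c)) (sym (trajectory-suc (choices (b ∷ bs)) c n))

  module Soundness (x : List Bool) (ch : ℕ → Bool) where

    at-time : ℕ → Config M
    at-time = trajectory ch (initial M x)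

    tape : ℕ → Fin (suc k) → Tape Aux
    tape t = lookup (tapes (at-time t))

    Holds : Fact → (t i : ℕ) → Set
    Holds (choice b)   t i = ch t ≡ b
    Holds (state q)    t i = control (at-time t) ≡ q
    Holds (cell s j y) t i = stream s (tape t j) i ≡ y

    -- The valuation of the run: a variable is true if it names a fact that holds. No decision
    -- procedure is needed, as the semantics is doubly negated.
    Named : ℕ → Set
    Named v = ∃[ a ] ∃[ t ] ∃[ i ] v ≡ toℕ₂ (fields (t ∷ i ∷ code a)) × Holds a t i

    open Semantics Named

    holds : ∀ a t i → Holds a t i → ⟦ name a t i ⟧
    holds a t i h c = c (a , t , i , refl , h)

    -- The fact behind a true variable is known only existentially; by injectivity of the naming it
    -- is the expected one.
    use : ∀ a t i φ → ⟦ name a t i ⟧ → (Holds a t i → ⟦ φ ⟧) → ⟦ φ ⟧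
    use a t i φ p f = bind φ p λ (_ , _ , _ , eq , h) →
      f (named (fields-injective _ _ (ℕᵇ.toℕ-injective eq)) h)
      where
      named : ∀ {a′ t′ i′} → _≡_ {A = List ℕ} (t ∷ i ∷ code a) (t′ ∷ i′ ∷ code a′) →
        Holds a′ t′ i′ → Holds a t i
      named {a′} eq h with ∷-injectiveˡ eq | ∷-injectiveˡ (∷-injectiveʳ eq)
                         | code-injective {a} {a′} (∷-injectiveʳ (∷-injectiveʳ eq))
      ... | refl | refl | refl = h

    module _ (ρ : Register → ℕ) where

      True : Template → Set
      True a = ⟦ instantiate ρ a ⟧

      private
        t = ρ T

      scans-true : ∀ js σ a → ((∀ {j} → j ∈ js → scanned (tape t j) ≡ lookup σ j) → True a) →
        True (scans js σ a)
      scans-true []       σ a f = f λ ()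
      scans-true (j ∷ js) σ a f p = use (cell R j (lookup σ j)) t 0 (instantiate ρ (scans js σ a)) p λ h →
        scans-true js σ a λ hs → f λ { (here refl) → h ; (there i) → hs i }

      given-true : ∀ b q σ a →
        (ch t ≡ b → control (at-time t) ≡ running q → (∀ j → scanned (tape t j) ≡ lookup σ j) → True a) →
        True (given b q σ a)
      given-true b q σ a f p₁ p₂ =
        use (choice b) t 0 φ p₁ λ h₁ → use (state (running q)) t 0 φ p₂ λ h₂ →
        scans-true (allFin (suc k)) σ a λ hs → f h₁ h₂ λ j → hs (∈-allFin j)
        where
        φ = instantiate ρ (scans (allFin (suc k)) σ a)

      cellRules-true : ∀ j w m s p → tape (suc t) j ≡ writeMove (w , m) (tape t j) →
        All True (cellRules j (w , m) s p)
      cellRules-true j w m s p written with source m s p | stream-writeMove ρ w m (tape t j) s p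
      ... | nothing       | eq =
        holds (cell s j w) (suc t) i′ (trans (cong (λ u → stream s u i′) written) eq) ∷ []
        where i′ = eval ρ (offset p)
      ... | just (s′ , i) | eq = All-mapped
        {f = λ y → now (cell s′ j y) i ⊃ next (cell s j y) (offset p)}
        (λ y q → use (cell s′ j y) t (eval ρ i) (name (cell s j y) (suc t) i′) q λ h →
          holds (cell s j y) (suc t) i′ (trans (cong (λ u → stream s u i′) written) (trans eq h)))
        symbols
        where i′ = eval ρ (offset p)

      effects-true : ∀ q′ acts →
        at-time (suc t) ≡ config q′ (Vec.zipWith writeMove acts (tapes (at-time t))) →
        All True (effects (q′ , acts))
      effects-true q′ acts eq = holds (state q′) (suc t) 0 (cong control eq) ∷
        All-concatMap (λ j → All-concatMap (λ s → All-concatMap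
          (λ p → cellRules-true j (proj₁ (lookup acts j)) (proj₂ (lookup acts j)) s p (written j))
          offsets) sides) (allFin (suc k))
        where
        written : ∀ j → tape (suc t) j ≡ writeMove (lookup acts j) (tape t j)
        written j = trans (cong (λ c → lookup (tapes c) j) eq) (lookup-zipWith writeMove j acts _)

      persist-true : ∀ q → (∀ b ts → step M b (config q ts) ≡ config q ts) →
        True (now (state q) (# 0) ⊃ next (state q) (# 0))
      persist-true q halted p = use (state q) t 0 (name (state q) (suc t) 0) p λ h →
        holds (state q) (suc t) 0 (stays (at-time t) h)
        where
        stays : ∀ c → control c ≡ q → control (step M (ch t) c) ≡ q
        stays (config _ ts) refl = cong control (halted (ch t) ts)

      rules-true : All True rules
      rules-true =
        (λ f → f (chosen (ch t) refl)) ∷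
        persist-true accept (λ b ts → refl) ∷
        persist-true reject (λ b ts → refl) ∷
        All-concatMap (λ b → All-concatMap (λ q → All-concatMap (λ σ →
          All.map⁺ {f = given b q σ} (All.tabulate λ {a} a∈ → given-true b q σ a λ h₁ h₂ h₃ →
            All.lookup (effects-true _ _ (trans (cong (λ b → step M b (at-time t)) h₁)
              (step-running (at-time t) h₂ (scanned-ext (tapes (at-time t)) σ h₃)))) a∈))
          (words (suc k))) (elements (proj₂ (TM.finite-State M)))) (true ∷ false ∷ [])
        where
        chosen : ∀ b → ch t ≡ b →
          ⟦ name (choice true) t 0 ⟧ ⊎ ⟦ name (choice false) t 0 ⟧
        chosen true  eq = inj₁ (holds (choice true) t 0 eq)
        chosen false eq = inj₂ (holds (choice false) t 0 eq)

    blanks-true : ∀ i t → All (True (heights (length x) i t)) blanks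
    blanks-true i t = All-concatMap (λ s → All-mapped
      {f = blankRule s}
      (λ j → holds (cell s j blank) 0 (eval (heights (length x) i t) (blankIndex s j)) (blank-at s j))
      (allFin (suc k))) sides
      where
      blank-at : ∀ s j → stream s (tape 0 j) (eval (heights (length x) i t) (blankIndex s j)) ≡ blank
      blank-at L j       = initial-blank x L j i λ ()
      blank-at R zero    = initial-blank x R zero (length x + i) λ _ _ → m≤m+n (length x) i
      blank-at R (suc j) = initial-blank x R (suc j) i λ _ ()

    hypotheses-true : ∀ N → All ⟦_⟧ (hypotheses (reverse x) (length x) N)
    hypotheses-true N = holds (state (running (TM.start M))) 0 0 refl ∷
      All.++⁺ (All-gatherBits x [] [] λ i b eq →
        holds (cell R zero (bit b)) 0 i (trans (stream-inputTape x i) eq) ∷ [])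
        (All.++⁺ (All-gather (λ i → All.map⁺ (blanks-true i 0)) N)
          (All-gather (λ t → All-gather (λ i → All.map⁺ (rules-true (heights (length x) i t))) N) N))

    rejects : ∀ N → ⊢ foldr _⇒_ (conclusion (length x) N) (hypotheses (reverse x) (length x) N) →
      control (at-time N) ≡ accept → ⊥
    rejects N p acc =
      -- `use` eliminates into formulas only, and there is no constant for falsity. As ∘ is read as
      -- truth, this formula denotes `⊤ → ⊥`; the final `_` is its argument.
      use (state reject) N 0 (¬ (∘ name (state reject) N 0)) (apply-all _ (sound p) (hypotheses-true N))
        (λ rej _ → accept≢reject (trans (sym acc) rej)) _
      where
      accept≢reject : accept ≡ reject → ⊥
      accept≢reject ()

-- A derivation if all runs reject

source-≤ : ∀ ρ m s p {s′ i} → source m s p ≡ just (s′ , i) → eval ρ i ≤ suc (eval ρ (offset p))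
source-≤ ρ stay  L p       refl = n≤1+n _
source-≤ ρ stay  R first   ()
source-≤ ρ stay  R second  refl = n≤1+n _
source-≤ ρ stay  R further refl = n≤1+n _
source-≤ ρ right R p       refl = ≤-refl
source-≤ ρ right L first   ()
source-≤ ρ right L second  refl = z≤n
source-≤ ρ right L further refl = m≤n+m _ 2
source-≤ ρ left  L p       refl = ≤-refl
source-≤ ρ left  R first   refl = z≤n
source-≤ ρ left  R second  ()
source-≤ ρ left  R further refl = m≤n+m _ 2

module _ (M : NTM) where

  open TM M using (State; Aux; δ; finite-State) renaming (workTapes to k)
  open Tableau M
  open Generator goal start rules blanks facts

  module Completeness (x : List Bool) (N : ℕ) where

    n : ℕ
    n = length x

    Γ : List Formula
    Γ = hypotheses (reverse x) n N

    tape : Config M → Fin (suc k) → Tape Aux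
    tape c = lookup (tapes c)

    -- Knowledge of the cells shrinks by one per step, as a move can bring in a
    -- cell from one further out.
    Tracks : List Formula → ℕ → Config M → Set
    Tracks Δ t c = Δ ⊩ name (state (control c)) t 0 ×
      (∀ {q} → control c ≡ running q → ∀ s j i → i + t < N →
        Δ ⊩ name (cell s j (stream s (tape c j) i)) t i)

    Tracks-weaken : ∀ {Δ Θ t c} → Δ ⊆ Θ → Tracks Δ t c → Tracks Θ t c
    Tracks-weaken Δ⊆Θ (p , f) = weaken Δ⊆Θ p , λ eq s j i lt → weaken Δ⊆Θ (f eq s j i lt)

    module _ {Δ : List Formula} (Γ⊆Δ : Γ ⊆ Δ) where

      rule : ∀ {a i t} → a ∈ rules → i < N → t < N → Δ ⊩ instantiate (heights n i t) a
      rule a∈ i<N t<N = hyp (Γ⊆Δ (there (∈-++⁺ʳ (bitFacts facts (reverse x))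
        (∈-++⁺ʳ (row blanks n 0 N) (∈-gather t<N (∈-gather i<N (∈-map⁺ _ a∈)))))))

      initially-blank : ∀ s j {i} → i < N →
        Δ ⊩ name (cell s j blank) 0 (eval (heights n i 0) (blankIndex s j))
      initially-blank s j {i} i<N = hyp (Γ⊆Δ (there (∈-++⁺ʳ (bitFacts facts (reverse x)) (∈-++⁺ˡ
        (∈-gather i<N (∈-map⁺ (instantiate (heights n i 0))
          (∈-concatMap (λ s → List.map (blankRule s) (allFin (suc k))) (∈-sides s)
          (∈-map⁺ (blankRule s) (∈-allFin j)))))))))

      Tracks-initial : Tracks Δ 0 (initial M x)
      Tracks-initial = hyp (Γ⊆Δ (here refl)) , λ _ s j i lt → cells s j i (subst (_< N) (+-identityʳ i) lt)
        where
        blank-cell : ∀ s j i → stream s (tape (initial M x) j) i ≡ blank → Δ ⊩ name (cell s j blank) 0 i →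
          Δ ⊩ name (cell s j (stream s (tape (initial M x) j) i)) 0 i
        blank-cell s j i eq p rewrite eq = p
        cells : ∀ s j i → i < N → Δ ⊩ name (cell s j (stream s (tape (initial M x) j) i)) 0 i
        cells L j i i<N = blank-cell L j i (initial-blank M x L j i λ ()) (initially-blank L j i<N)
        cells R (suc j) i i<N =
          blank-cell R (suc j) i (initial-blank M x R (suc j) i λ _ ()) (initially-blank R (suc j) i<N)
        cells R zero i i<N with <-≤-connex i n
        -- Cell i is the instance of the blank rule with C at height `i ∸ n`.
        ... | inj₂ n≤i = blank-cell R zero i (initial-blank M x R zero i λ _ _ → n≤i)
          (subst (λ i → Δ ⊩ name (cell R zero blank) 0 i) (m+[n∸m]≡n n≤i)
            (initially-blank R zero (≤-<-trans (m∸n≤m i n) i<N)))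
        ... | inj₁ i<n with ∈-gatherBits {A = Aux}
          {f = λ m b → List.map (instantiate (heights m 0 0)) (facts b)} x [] i<n
        ... | b , eq , ⊆g = subst (λ y → Δ ⊩ name (cell R zero y) 0 i) (sym (trans (stream-inputTape x i) eq))
          (hyp (Γ⊆Δ (there (∈-++⁺ˡ (⊆g (here refl))))))

      scans-fire : ∀ ρ js σ a → Δ ⊩ instantiate ρ (scans js σ a) →
        (∀ j → Δ ⊩ name (cell R j (lookup σ j)) (ρ T) 0) → Δ ⊩ instantiate ρ a
      scans-fire ρ []       σ a p f = p
      scans-fire ρ (j ∷ js) σ a p f = scans-fire ρ js σ a (app p (f j)) f

      -- Among the copying clauses, the one for the symbol actually on the tape is used.
      source-fire : ∀ ρ j w (u : Tape Aux) src s p →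
        (∀ {a} → a ∈ sourceRules j w src s p → Δ ⊩ instantiate ρ a) →
        (∀ {s′ i} → src ≡ just (s′ , i) → Δ ⊩ name (cell s′ j (stream s′ u (eval ρ i))) (ρ T) (eval ρ i)) →
        Δ ⊩ name (cell s j (sourced ρ w u src)) (suc (ρ T)) (eval ρ (offset p))
      source-fire ρ j w u nothing         s p f g = f (here refl)
      source-fire ρ j w u (just (s′ , i)) s p f g =
        app (f (∈-map⁺ (λ y → now (cell s′ j y) i ⊃ next (cell s j y) (offset p))
               (∈-symbols (stream s′ u (eval ρ i)))))
          (g refl)

      Tracks-step : ∀ {t b} c → t < N → Δ ⊩ name (choice b) t 0 → Tracks Δ t c → Tracks Δ (suc t) (step M b c)
      Tracks-step (config accept ts) t<N p (st , _) =
        -- The rule does not mention C, so height 0 serves; it is in range because `t < N` makes N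
        -- positive.
        app (rule {i = 0} (there (here refl)) (m<n⇒0<n t<N) t<N) st , λ ()
      Tracks-step (config reject ts) t<N p (st , _) =
        app (rule {i = 0} (there (there (here refl))) (m<n⇒0<n t<N) t<N) st , λ ()
      Tracks-step {t} {b} (config (running q) ts) t<N p (st , cells) =
        effect {i = 0} (here refl) (m<n⇒0<n t<N) , λ _ → cells′
        where
        σ    = Vec.map scanned ts
        acts = proj₂ (δ b q σ)
        effect : ∀ {a i} → a ∈ effects (δ b q σ) → i < N → Δ ⊩ instantiate (heights n i t) a
        effect {a} {i} a∈ i<N = scans-fire (heights n i t) (allFin (suc k)) σ a
          (app (app (rule {given b q σ a} (there (there (there (∈-concatMap choiceRules (∈-bools b)
            (∈-concatMap (λ q → concatMap (stepRules b q) (words (suc k))) (∈-elements (proj₂ finite-State) q)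
            (∈-concatMap (stepRules b q) (∈-words σ) (∈-map⁺ (given b q σ) a∈))))))) i<N t<N) p) st)
          λ j → subst (λ y → Δ ⊩ name (cell R j y) t 0) (sym (lookup-map j scanned ts)) (cells refl R j 0 t<N)
          where
          ∈-bools : ∀ b → b ∈ true ∷ false ∷ []
          ∈-bools true  = here refl
          ∈-bools false = there (here refl)
        cells′ : ∀ s j i → i + suc t < N →
          Δ ⊩ name (cell s j (stream s (lookup (Vec.zipWith writeMove acts ts) j) i)) (suc t) i
        cells′ s j i lt with offset-surjective {n} {t} i (≤-<-trans (m≤m+n i (suc t)) lt)
        ... | o , h , h<N , refl =
          subst (λ y → Δ ⊩ name (cell s j y) (suc t) (eval ρ (offset o)))
            (sym (trans (cong (λ u → stream s u (eval ρ (offset o))) (lookup-zipWith writeMove j acts ts))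
                        (stream-writeMove ρ w m (lookup ts j) s o)))
            (source-fire ρ j w (lookup ts j) (source m s o) s o
              (λ a∈ → effect (there (∈-concatMap (tapeRules acts) (∈-allFin j)
                (∈-concatMap (λ s → concatMap (cellRules j (lookup acts j) s) offsets) (∈-sides s)
                (∈-concatMap (cellRules j (lookup acts j) s) (∈-offsets o) a∈)))) h<N)
              -- The source is at most one cell further out, which the later time makes up for:
              -- `i + suc t` and `suc i + t` are equal.
              (λ {s′} {i′} eq → cells refl s′ j (eval ρ i′)
                (≤-<-trans (+-monoˡ-≤ t (source-≤ ρ m s o eq)) (subst (_< N) (+-suc _ t) lt))))
          where
          ρ = heights n h t
          w = proj₁ (lookup acts j)
          m = proj₂ (lookup acts j)

    -- Induction on the number r of remaining steps. Both choices are explored at every step, so the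
    -- derivation is exponential in N; only its existence matters.
    derive : ∀ r {t Δ} c → Γ ⊆ Δ → r + t ≡ N → Tracks Δ t c →
      (∀ (bs : Vec Bool r) → control (run M bs c) ≡ reject) → Δ ⊩ conclusion n N
    derive zero    {Δ = Δ} c Γ⊆Δ refl tracks rejecting =
      subst (λ q → Δ ⊩ name (state q) N 0) (rejecting []) (proj₁ tracks)
    derive (suc r) {t} {Δ} c Γ⊆Δ eq tracks rejecting =
      ∨-elim (rule Γ⊆Δ {i = 0} (here refl) (m<n⇒0<n t<N) t<N) (branch true) (branch false)
      where
      t<N : t < N
      t<N = subst (t <_) eq (s≤s (m≤n+m t r))
      branch : ∀ b → name (choice b) t 0 ∷ Δ ⊩ conclusion n N
      branch b = derive r (step M b c) Γ⊆ (trans (+-suc r t) eq)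
        (Tracks-step Γ⊆ c t<N (hyp (here refl)) (Tracks-weaken {c = c} there tracks))
        (λ bs → rejecting (b ∷ bs))
        where
        Γ⊆ : Γ ⊆ name (choice b) t 0 ∷ Δ
        Γ⊆ i = there (Γ⊆Δ i)

    complete : (∀ (bs : Vec Bool N) → control (run M bs (initial M x)) ≡ reject) →
      ⊢ foldr _⇒_ (conclusion n N) Γ
    complete rejecting = discharge-all Γ λ Γ⊆Θ →
      derive N (initial M x) Γ⊆Θ (+-identityʳ N) (Tracks-initial Γ⊆Θ) rejecting

-- The reduction

corollary6p2 : coNP-hard Val-RmbC
corollary6p2 U (P , (M , c , k , decides) , U⊆∁P , ∁P⊆U) =
  (λ x → encode (formula c k x)) , PolyTime-formula c k , λ x → mk⇔ (valid x) (member x)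
  where
  open Tableau M
  open Generator goal start rules blanks facts

  valid : ∀ x → U x → Val-RmbC (encode (formula c k x))
  valid x x∈U = formula c k x , refl , Completeness.complete M x (polyBound c k (length x)) rejecting
    where
    rejecting : (bs : Vec Bool (polyBound c k (length x))) → control (run M bs (initial M x)) ≡ reject
    rejecting bs with control (run M bs (initial M x)) in eq | proj₁ (decides x) bs
    -- All runs halt, so it remains to exclude acceptance, which would put x into P.
    ... | accept | _ = ⊥-elim (U⊆∁P x∈U (Equivalence.from (proj₂ (decides x)) (bs , eq)))
    ... | reject | _ = refl

  member : ∀ x → Val-RmbC (encode (formula c k x)) → U x
  -- U contains the complement of P, so it suffices to refute membership in P, that is, to refute an
  -- accepting run.
  member x (φ , eq , ⊢φ) = ∁P⊆U λ x∈P →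
    let bs , accepts = Equivalence.to (proj₂ (decides x)) x∈P in
    Soundness.rejects M x (choices M bs) (polyBound c k (length x))
      (subst ⊢_ (sym (encode-injective {formula c k x} {φ} eq)) ⊢φ)
      (trans (cong control (sym (run-trajectory M bs (initial M x)))) accepts)
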